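{- For every positive integer $k$, $$\sum_{i=1}^k(-1)^i\,i!\,(\ln2)^{k-i}\binom ki\left\{\zeta\left(2,\{1\}_{i-1}\right)-\zeta\left(2,\{1\}_{i-1};\tfrac12\right)\right\}=(-1)^k\,k!\,\mathrm{Li}_{k+1}\left(\tfrac12\right)-(\ln2)^{k+1}.$$
   Context: Notation. $\{1\}_r$ denotes the string of $r$ entries equal to $1$ (empty if $r=0$). For positive integers $s_1,\dots,s_r$ with $s_1\ge2$, $\zeta(s_1,\dots,s_r):=\sum_{k_1>\cdots>k_r\ge1}\frac{1}{k_1^{s_1}\cdots k_r^{s_r}}$; for $x\in[-1,1)$, $\zeta(s_1,\dots,s_r;x):=\sum_{k_1>\cdots>k_r\ge1}\frac{x^{k_1}}{k_1^{s_1}\cdots k_r^{s_r}}$; and $\mathrm{Li}_p(x):=\sum_{n\ge1}x^n/n^p$. -}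

module Defs where

import Data.Integer.Base as ℤ
import Data.Integer.Properties as ℤ
open import Data.List.Base using (List; []; _∷_; length; replicate)
open import Data.List.Relation.Unary.All using (All; []; _∷_)
open import Data.Nat.Base as ℕ using (ℕ; zero; suc; pred; z≤n; s≤s)
import Data.Nat.Properties as ℕ
open import Data.Product using (∃-syntax; _×_; _,_; proj₁; proj₂)
open import Data.Rational.Base
  using (ℚ; mkℚ; 0ℚ; 1ℚ; ½; _+_; _*_; _-_; -_; _/_; _÷_; 1/_; _≤_; _<_; ∣_∣;
         toℚᵘ; Positive; positive; nonNegative; ≢-nonZero; *≤*; *<*)
import Data.Rational.Base as ℚ
open import Data.Rational.Properties
open import Data.Rational.Solver using (module +-*-Solver)
open import Data.Rational.Unnormalised.Base as ℚᵘ using (mkℚᵘ)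
import Data.Rational.Unnormalised.Properties as ℚᵘ
open import Data.Sum.Base using (inj₁; inj₂)
open import Relation.Binary.PropositionalEquality
  using (_≡_; refl; sym; trans; cong; cong₂; subst; subst₂)
open import Relation.Nullary using (yes; no; contradiction)
open import Relation.Nullary.Decidable using (True; toWitness)

open import Algebra.Definitions.RawSemiring ℚ.+-*-rawSemiring using (_^_)

ι : ℕ → ℚ
ι n = ℤ.+ n / 1

-- Reciprocals made total by 1/0 = 0; that value never enters the sums and
-- integrals below.

recip : ℕ → ℚ
recip zero    = 0ℚ
recip (suc n) = ℤ.+ 1 / suc n

inv : ℚ → ℚ
inv q with q ≟ 0ℚ
... | yes _   = 0ℚ
... | no  q≢0 = (1/ q) {{≢-nonZero q≢0}}

-- ∑₁ n f = f 1 + f 2 + ⋯ + f n.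

∑₁ : ℕ → (ℕ → ℚ) → ℚ
∑₁ zero    f = 0ℚ
∑₁ (suc n) f = ∑₁ n f + f (suc n)

module RationalLemmas where

  ι-suc : ∀ n → ι (suc n) ≡ ι n + 1ℚ
  ι-suc n = toℚᵘ-injective (begin
    toℚᵘ (ι (suc n))             ≈⟨ toℚᵘ-fromℚᵘ (mkℚᵘ (ℤ.+ suc n) 0) ⟩
    mkℚᵘ (ℤ.+ suc n) 0           ≈⟨ ℚᵘ.*≡* (lem n) ⟩
    mkℚᵘ (ℤ.+ n) 0 ℚᵘ.+ mkℚᵘ (ℤ.+ 1) 0
      ≈⟨ ℚᵘ.+-congˡ (mkℚᵘ (ℤ.+ 1) 0) (ℚᵘ.≃-sym (toℚᵘ-fromℚᵘ (mkℚᵘ (ℤ.+ n) 0))) ⟩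
    toℚᵘ (ι n) ℚᵘ.+ toℚᵘ 1ℚ      ≈⟨ ℚᵘ.≃-sym (toℚᵘ-homo-+ (ι n) 1ℚ) ⟩
    toℚᵘ (ι n + 1ℚ)              ∎)
    where
    open import Relation.Binary.Reasoning.Setoid ℚᵘ.≃-setoid
    lem : ∀ n → (ℤ.+ suc n) ℤ.* (ℤ.+ 1) ≡ ((ℤ.+ n) ℤ.* (ℤ.+ 1) ℤ.+ (ℤ.+ 1) ℤ.* (ℤ.+ 1)) ℤ.* (ℤ.+ 1)
    lem n = cong (ℤ._* (ℤ.+ 1)) (trans (cong ℤ.+_ (ℕ.+-comm 1 n)) (cong (ℤ._+ (ℤ.+ 1)) (sym (ℤ.*-identityʳ (ℤ.+ n)))))

  ι-+ : ∀ m n → ι (m ℕ.+ n) ≡ ι m + ι n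
  ι-+ zero    n = sym (+-identityˡ (ι n))
  ι-+ (suc m) n = begin
    ι (suc (m ℕ.+ n))      ≡⟨ ι-suc (m ℕ.+ n) ⟩
    ι (m ℕ.+ n) + 1ℚ       ≡⟨ cong (_+ 1ℚ) (ι-+ m n) ⟩
    (ι m + ι n) + 1ℚ       ≡⟨ solve 2 (λ a b → (a :+ b) :+ con 1ℚ := (a :+ con 1ℚ) :+ b) refl (ι m) (ι n) ⟩
    (ι m + 1ℚ) + ι n       ≡⟨ cong (_+ ι n) (sym (ι-suc m)) ⟩
    ι (suc m) + ι n        ∎
    where open Relation.Binary.PropositionalEquality.≡-Reasoning
          open +-*-Solver

  ι-* : ∀ m n → ι (m ℕ.* n) ≡ ι m * ι n
  ι-* zero    n = sym (*-zeroˡ (ι n))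
  ι-* (suc m) n = begin
    ι (n ℕ.+ m ℕ.* n)      ≡⟨ ι-+ n (m ℕ.* n) ⟩
    ι n + ι (m ℕ.* n)      ≡⟨ cong (ι n +_) (ι-* m n) ⟩
    ι n + ι m * ι n        ≡⟨ solve 2 (λ a b → b :+ a :* b := (a :+ con 1ℚ) :* b) refl (ι m) (ι n) ⟩
    (ι m + 1ℚ) * ι n       ≡⟨ cong (_* ι n) (sym (ι-suc m)) ⟩
    ι (suc m) * ι n        ∎
    where open Relation.Binary.PropositionalEquality.≡-Reasoning
          open +-*-Solver

  0≤1 : 0ℚ ≤ 1ℚ
  0≤1 = *≤* (ℤ.+≤+ z≤n)

  0<1 : 0ℚ < 1ℚ
  0<1 = *<* (ℤ.+<+ (s≤s z≤n))

  +-nonneg : ∀ {p q} → 0ℚ ≤ p → 0ℚ ≤ q → 0ℚ ≤ p + q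
  +-nonneg {p} {q} 0≤p 0≤q = subst (_≤ p + q) (+-identityˡ 0ℚ) (+-mono-≤ 0≤p 0≤q)

  *-mono-l : ∀ {p q} r → 0ℚ ≤ r → p ≤ q → r * p ≤ r * q
  *-mono-l r 0≤r = *-monoˡ-≤-nonNeg r {{nonNegative 0≤r}}

  *-mono-r : ∀ {p q} r → 0ℚ ≤ r → p ≤ q → p * r ≤ q * r
  *-mono-r r 0≤r = *-monoʳ-≤-nonNeg r {{nonNegative 0≤r}}

  *-mono : ∀ {p q r s} → 0ℚ ≤ p → 0ℚ ≤ s → p ≤ q → r ≤ s → p * r ≤ q * s
  *-mono {p} {q} {r} {s} 0≤p 0≤s p≤q r≤s =
    ≤-trans (*-mono-l p 0≤p r≤s) (*-mono-r s 0≤s p≤q)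

  *-nonneg : ∀ {p q} → 0ℚ ≤ p → 0ℚ ≤ q → 0ℚ ≤ p * q
  *-nonneg {p} {q} 0≤p 0≤q = subst (_≤ p * q) (*-zeroʳ p) (*-mono-l p 0≤p 0≤q)

  *-pos : ∀ {p q} → 0ℚ < p → 0ℚ < q → 0ℚ < p * q
  *-pos {p} {q} 0<p 0<q =
    positive⁻¹ (p * q) {{pos*pos⇒pos p {{positive 0<p}} q {{positive 0<q}}}}

  +-pos : ∀ {p q} → 0ℚ < p → 0ℚ ≤ q → 0ℚ < p + q
  +-pos {p} {q} 0<p 0≤q = subst (_< p + q) (+-identityˡ 0ℚ) (+-mono-<-≤ 0<p 0≤q)

  ≤-+ʳ : ∀ p {q} → 0ℚ ≤ q → p ≤ p + q
  ≤-+ʳ p {q} 0≤q = subst (_≤ p + q) (+-identityʳ p) (+-monoʳ-≤ p 0≤q)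

  ≤-+ˡ : ∀ p {q} → 0ℚ ≤ q → p ≤ q + p
  ≤-+ˡ p {q} 0≤q = subst (_≤ q + p) (+-identityˡ p) (+-monoˡ-≤ p 0≤q)

  p≤q⇒0≤q-p : ∀ {p q} → p ≤ q → 0ℚ ≤ q - p
  p≤q⇒0≤q-p {p} {q} p≤q = subst (_≤ q - p) (+-inverseʳ p) (+-monoˡ-≤ (- p) p≤q)

  0≤q-p⇒p≤q : ∀ {p q} → 0ℚ ≤ q - p → p ≤ q
  0≤q-p⇒p≤q {p} {q} h = subst₂ _≤_ (+-identityˡ p) lem (+-monoˡ-≤ p h)
    where
    open +-*-Solver
    lem : q - p + p ≡ q
    lem = solve 2 (λ p q → q :- p :+ p := q) refl p q

  p-q≤p : ∀ p {q} → 0ℚ ≤ q → p - q ≤ p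
  p-q≤p p {q} 0≤q = 0≤q-p⇒p≤q (subst (0ℚ ≤_) (solve 2 (λ p q → q := p :- (p :- q)) refl p q) 0≤q)
    where open +-*-Solver

  p<q⇒0<q-p : ∀ {p q} → p < q → 0ℚ < q - p
  p<q⇒0<q-p {p} {q} p<q = subst (_< q - p) (+-inverseʳ p) (+-monoˡ-< (- p) p<q)

  half-pos : ∀ {ε} → 0ℚ < ε → 0ℚ < ½ * ε
  half-pos = *-pos {½} (*<* (ℤ.+<+ (s≤s z≤n)))

  half+half : ∀ ε → ½ * ε + ½ * ε ≡ ε
  half+half ε = solve 1 (λ ε → con ½ :* ε :+ con ½ :* ε := ε) refl ε
    where open +-*-Solver

  ∣p-q∣≡∣q-p∣ : ∀ p q → ∣ p - q ∣ ≡ ∣ q - p ∣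
  ∣p-q∣≡∣q-p∣ p q = trans (sym (∣-p∣≡∣p∣ (p - q)))
    (cong ∣_∣ (solve 2 (λ p q → :- (p :- q) := q :- p) refl p q))
    where open +-*-Solver

  ∣_∣≤ : ∀ p {q} → p ≤ q → - p ≤ q → ∣ p ∣ ≤ q
  ∣ p ∣≤ {q} h₁ h₂ with ∣p∣≡p∨∣p∣≡-p p
  ... | inj₁ e = subst (_≤ q) (sym e) h₁
  ... | inj₂ e = subst (_≤ q) (sym e) h₂

  ι-nonneg : ∀ n → 0ℚ ≤ ι n
  ι-nonneg zero    = ≤-refl
  ι-nonneg (suc n) = subst (0ℚ ≤_) (sym (ι-suc n)) (+-nonneg (ι-nonneg n) 0≤1)

  ι-pos : ∀ n → 0ℚ < ι (suc n)
  ι-pos n = subst (0ℚ <_) (trans (+-comm 1ℚ (ι n)) (sym (ι-suc n))) (+-pos 0<1 (ι-nonneg n))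

  ι-mono : ∀ {m n} → m ℕ.≤ n → ι m ≤ ι n
  ι-mono {m} {n} m≤n = subst (ι m ≤_)
    (trans (sym (ι-+ m (n ℕ.∸ m))) (cong ι (ℕ.m+[n∸m]≡n m≤n)))
    (≤-+ʳ (ι m) (ι-nonneg (n ℕ.∸ m)))

  1≤ι-suc : ∀ n → 1ℚ ≤ ι (suc n)
  1≤ι-suc n = ι-mono {1} {suc n} (s≤s z≤n)

  recip-inv : ∀ n → recip (suc n) * ι (suc n) ≡ 1ℚ
  recip-inv n = toℚᵘ-injective (begin
    toℚᵘ (recip (suc n) * ι (suc n))           ≈⟨ toℚᵘ-homo-* (recip (suc n)) (ι (suc n)) ⟩
    toℚᵘ (recip (suc n)) ℚᵘ.* toℚᵘ (ι (suc n))
      ≈⟨ ℚᵘ.*-cong (toℚᵘ-fromℚᵘ (mkℚᵘ (ℤ.+ 1) n)) (toℚᵘ-fromℚᵘ (mkℚᵘ (ℤ.+ suc n) 0)) ⟩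
    mkℚᵘ (ℤ.+ 1) n ℚᵘ.* mkℚᵘ (ℤ.+ suc n) 0         ≈⟨ ℚᵘ.*≡* (lem n) ⟩
    toℚᵘ 1ℚ                                    ∎)
    where
    open import Relation.Binary.Reasoning.Setoid ℚᵘ.≃-setoid
    lem : ∀ n → (ℤ.+ 1) ℤ.* (ℤ.+ suc n) ℤ.* (ℤ.+ 1) ≡ (ℤ.+ 1) ℤ.* (ℤ.+ (suc n ℕ.* 1))
    lem n = trans (ℤ.*-identityʳ _) (cong (λ m → (ℤ.+ 1) ℤ.* (ℤ.+ m)) (sym (ℕ.*-identityʳ (suc n))))

  recip-pos : ∀ n → 0ℚ < recip (suc n)
  recip-pos n = positive⁻¹ (recip (suc n)) {{normalize-pos 1 (suc n)}}

  recip-nonneg : ∀ n → 0ℚ ≤ recip n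
  recip-nonneg zero    = ≤-refl
  recip-nonneg (suc n) = <⇒≤ (recip-pos n)

  recip≤1 : ∀ n → recip n ≤ 1ℚ
  recip≤1 zero    = 0≤1
  recip≤1 (suc n) = subst₂ _≤_ (*-identityʳ _) (recip-inv n)
    (*-mono-l (recip (suc n)) (recip-nonneg (suc n)) (1≤ι-suc n))

  recip-diff : ∀ n → recip (suc n) - recip (suc (suc n)) ≡ recip (suc n) * recip (suc (suc n))
  recip-diff n = begin
    v - u                        ≡⟨ solve 2 (λ u v → v :- u := v :* con 1ℚ :- con 1ℚ :* u) refl u v ⟩
    v * 1ℚ - 1ℚ * u              ≡⟨ cong₂ (λ a b → v * a - b * u) (sym (recip-inv (suc n))) (sym (recip-inv n)) ⟩
    v * (u * ι (suc (suc n))) - v * a * u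
      ≡⟨ cong (λ b → v * (u * b) - v * a * u) (ι-suc (suc n)) ⟩
    v * (u * (a + 1ℚ)) - v * a * u
      ≡⟨ solve 3 (λ u v a → v :* (u :* (a :+ con 1ℚ)) :- v :* a :* u := v :* u) refl u v a ⟩
    v * u                        ∎
    where
    open Relation.Binary.PropositionalEquality.≡-Reasoning
    open +-*-Solver
    u v a : ℚ
    u = recip (suc (suc n)) ; v = recip (suc n) ; a = ι (suc n)

  recip-anti : ∀ n → recip (suc (suc n)) ≤ recip (suc n)
  recip-anti n = 0≤q-p⇒p≤q (subst (0ℚ ≤_) (sym (recip-diff n))
    (*-nonneg (recip-nonneg (suc n)) (recip-nonneg (suc (suc n)))))

  archimedean : ∀ c {ε} → 0ℚ < ε → ∃[ N ] c ≤ ι N * ε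
  archimedean c {ε} 0<ε = N , subst (_≤ ι N * ε) lem (*-mono-r ε (<⇒≤ 0<ε) (q≤N q))
    where
    instance
      _ = positive 0<ε
      _ = pos⇒nonZero ε
    q = c ÷ ε
    N = ℤ.∣ ℚ.↥ q ∣
    lem : q * ε ≡ c
    lem = trans (*-assoc c (1/ ε) ε) (trans (cong (c *_) (*-inverseˡ ε)) (*-identityʳ c))
    i≤∣i∣ : ∀ i → i ℤ.≤ ℤ.+ ℤ.∣ i ∣
    i≤∣i∣ (ℤ.+ n)        = ℤ.≤-refl
    i≤∣i∣ (ℤ.-[1+ n ]) = ℤ.-≤+
    q≤N : ∀ q → q ≤ ι ℤ.∣ ℚ.↥ q ∣
    q≤N q@(mkℚ i d _) = toℚᵘ-cancel-≤ (ℚᵘ.≤-respʳ-≃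
      (ℚᵘ.≃-sym (toℚᵘ-fromℚᵘ (mkℚᵘ (ℤ.+ ℤ.∣ i ∣) 0)))
      (ℚᵘ.*≤* (ℤ.≤-trans (subst (ℤ._≤ ℤ.+ ℤ.∣ i ∣) (sym (ℤ.*-identityʳ i)) (i≤∣i∣ i))
        (subst (ℤ._≤ ℤ.+ ℤ.∣ i ∣ ℤ.* ℤ.+ suc d) (ℤ.*-identityʳ (ℤ.+ ℤ.∣ i ∣))
          (ℤ.*-monoˡ-≤-nonNeg (ℤ.+ ℤ.∣ i ∣) (ℤ.+≤+ (s≤s (z≤n {d}))))))))

  ^-nonneg : ∀ {p} n → 0ℚ ≤ p → 0ℚ ≤ p ^ n
  ^-nonneg zero    _   = 0≤1
  ^-nonneg (suc n) 0≤p = *-nonneg 0≤p (^-nonneg n 0≤p)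

  ^-anti : ∀ {p} {m n} → 0ℚ ≤ p → p ≤ 1ℚ → m ℕ.≤ n → p ^ n ≤ p ^ m
  ^-anti {p} {n = zero}  0≤p p≤1 z≤n = ≤-refl
  ^-anti {p} {n = suc n} 0≤p p≤1 z≤n =
    subst (p ^ suc n ≤_) (*-identityʳ 1ℚ) (*-mono 0≤p 0≤1 p≤1 (^-anti {n = n} 0≤p p≤1 z≤n))
  ^-anti {p} 0≤p p≤1 (s≤s m≤n) = *-mono-l p 0≤p (^-anti 0≤p p≤1 m≤n)

  ∣^∣ : ∀ p n → ∣ p ^ n ∣ ≡ ∣ p ∣ ^ n
  ∣^∣ p zero    = refl
  ∣^∣ p (suc n) = trans (∣p*q∣≡∣p∣*∣q∣ p (p ^ n)) (cong (∣ p ∣ *_) (∣^∣ p n))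

  ∑-cong : ∀ n {f g} → (∀ k → f k ≡ g k) → ∑₁ n f ≡ ∑₁ n g
  ∑-cong zero    _ = refl
  ∑-cong (suc n) h = cong₂ _+_ (∑-cong n h) (h (suc n))

  ∑-nonneg : ∀ n {f} → (∀ k → 0ℚ ≤ f k) → 0ℚ ≤ ∑₁ n f
  ∑-nonneg zero    _ = ≤-refl
  ∑-nonneg (suc n) h = +-nonneg (∑-nonneg n h) (h (suc n))

  ∑-mono : ∀ n {f g} → (∀ k → f k ≤ g k) → ∑₁ n f ≤ ∑₁ n g
  ∑-mono zero    _ = ≤-refl
  ∑-mono (suc n) h = +-mono-≤ (∑-mono n h) (h (suc n))

open RationalLemmas

IsCauchy : (ℕ → ℚ) → Set
IsCauchy a = ∀ ε → 0ℚ < ε →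
  ∃[ N ] (∀ m n → N ℕ.≤ m → N ℕ.≤ n → ∣ a m - a n ∣ ≤ ε)

-- Cauchy reals: a rational sequence bundled with its modulus of convergence.

record ℝ : Set where
  constructor mkℝ
  field
    seq    : ℕ → ℚ
    cauchy : IsCauchy seq
open ℝ public

-- The equality of ℝ: two Cauchy sequences name the same real iff their difference tends to 0.

infix 4 _≃_
_≃_ : ℝ → ℝ → Set
x ≃ y = ∀ ε → 0ℚ < ε → ∃[ N ] (∀ n → N ℕ.≤ n → ∣ seq x n - seq y n ∣ ≤ ε)

module CauchyLemmas where

  const-cauchy : ∀ q → IsCauchy (λ _ → q)
  const-cauchy q ε 0<ε = 0 , λ _ _ _ _ →
    subst (λ d → ∣ d ∣ ≤ ε) (sym (+-inverseʳ q)) (<⇒≤ 0<ε)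

  +-cauchy : ∀ {a b} → IsCauchy a → IsCauchy b → IsCauchy (λ n → a n + b n)
  +-cauchy {a} {b} ca cb ε 0<ε with ca (½ * ε) (half-pos 0<ε) | cb (½ * ε) (half-pos 0<ε)
  ... | M , hM | N , hN = M ℕ.⊔ N , λ m n p q → begin
    ∣ (a m + b m) - (a n + b n) ∣
      ≡⟨ cong ∣_∣ (solve 4 (λ x y z w → (x :+ y) :- (z :+ w) := (x :- z) :+ (y :- w)) refl (a m) (b m) (a n) (b n)) ⟩
    ∣ (a m - a n) + (b m - b n) ∣      ≤⟨ ∣p+q∣≤∣p∣+∣q∣ (a m - a n) (b m - b n) ⟩
    ∣ a m - a n ∣ + ∣ b m - b n ∣
      ≤⟨ +-mono-≤ (hM m n (ℕ.m⊔n≤o⇒m≤o M N p) (ℕ.m⊔n≤o⇒m≤o M N q))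
                  (hN m n (ℕ.m⊔n≤o⇒n≤o M N p) (ℕ.m⊔n≤o⇒n≤o M N q)) ⟩
    ½ * ε + ½ * ε                      ≡⟨ half+half ε ⟩
    ε                                  ∎
    where open ≤-Reasoning
          open +-*-Solver

  neg-cauchy : ∀ {a} → IsCauchy a → IsCauchy (λ n → - a n)
  neg-cauchy {a} ca ε 0<ε with ca ε 0<ε
  ... | N , h = N , λ m n p q → subst (_≤ ε) (sym (lem m n)) (h m n p q)
    where
    open +-*-Solver
    lem : ∀ m n → ∣ - a m - - a n ∣ ≡ ∣ a m - a n ∣
    lem m n = trans (cong ∣_∣ (solve 2 (λ x y → :- x :- :- y := :- (x :- y)) refl (a m) (a n)))
                    (∣-p∣≡∣p∣ (a m - a n))

  eventually-bounded : ∀ {a} → IsCauchy a →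
    ∃[ B ] (0ℚ < B × ∃[ N ] (∀ n → N ℕ.≤ n → ∣ a n ∣ ≤ B))
  eventually-bounded {a} ca with ca 1ℚ 0<1
  ... | N , h = 1ℚ + ∣ a N ∣ , +-pos 0<1 (0≤∣p∣ (a N)) , N , λ n p → begin
    ∣ a n ∣                    ≡⟨ cong ∣_∣ (solve 2 (λ x y → x := (x :- y) :+ y) refl (a n) (a N)) ⟩
    ∣ (a n - a N) + a N ∣      ≤⟨ ∣p+q∣≤∣p∣+∣q∣ (a n - a N) (a N) ⟩
    ∣ a n - a N ∣ + ∣ a N ∣    ≤⟨ +-monoˡ-≤ ∣ a N ∣ (h n N p ℕ.≤-refl) ⟩
    1ℚ + ∣ a N ∣               ∎
    where open ≤-Reasoning
          open +-*-Solver

  *-cauchy : ∀ {a b} → IsCauchy a → IsCauchy b → IsCauchy (λ n → a n * b n)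
  *-cauchy {a} {b} ca cb ε 0<ε = K , bound
    where
    A = proj₁ (eventually-bounded {a} ca)
    0<A = proj₁ (proj₂ (eventually-bounded {a} ca))
    Nᵃ = proj₁ (proj₂ (proj₂ (eventually-bounded {a} ca)))
    hA = proj₂ (proj₂ (proj₂ (eventually-bounded {a} ca)))
    B = proj₁ (eventually-bounded {b} cb)
    0<B = proj₁ (proj₂ (eventually-bounded {b} cb))
    Nᵇ = proj₁ (proj₂ (proj₂ (eventually-bounded {b} cb)))
    hB = proj₂ (proj₂ (proj₂ (eventually-bounded {b} cb)))
    C = A + B
    instance
      C-pos : Positive C
      C-pos = positive (+-pos 0<A (<⇒≤ 0<B))
      C-nz : ℚ.NonZero C
      C-nz = pos⇒nonZero C
    δ = ε * 1/ C
    0<δ : 0ℚ < δ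
    0<δ = *-pos 0<ε (positive⁻¹ (1/ C) {{1/pos⇒pos C}})
    Mᵃ = proj₁ (ca δ 0<δ)
    Mᵇ = proj₁ (cb δ 0<δ)
    K = (Nᵃ ℕ.⊔ Nᵇ) ℕ.⊔ (Mᵃ ℕ.⊔ Mᵇ)
    bound : ∀ m n → K ℕ.≤ m → K ℕ.≤ n → ∣ a m * b m - a n * b n ∣ ≤ ε
    bound m n p q = begin
      ∣ a m * b m - a n * b n ∣
        ≡⟨ cong ∣_∣ (solve 4 (λ x y z w → x :* y :- z :* w := x :* (y :- w) :+ (x :- z) :* w)
             refl (a m) (b m) (a n) (b n)) ⟩
      ∣ a m * (b m - b n) + (a m - a n) * b n ∣
        ≤⟨ ∣p+q∣≤∣p∣+∣q∣ (a m * (b m - b n)) ((a m - a n) * b n) ⟩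
      ∣ a m * (b m - b n) ∣ + ∣ (a m - a n) * b n ∣
        ≡⟨ cong₂ _+_ (∣p*q∣≡∣p∣*∣q∣ (a m) (b m - b n)) (∣p*q∣≡∣p∣*∣q∣ (a m - a n) (b n)) ⟩
      ∣ a m ∣ * ∣ b m - b n ∣ + ∣ a m - a n ∣ * ∣ b n ∣
        ≤⟨ +-mono-≤
             (*-mono (0≤∣p∣ (a m)) (<⇒≤ 0<δ) (hA m (l₁ p)) (proj₂ (cb δ 0<δ) m n (l₄ p) (l₄ q)))
             (*-mono (0≤∣p∣ (a m - a n)) (<⇒≤ 0<B) (proj₂ (ca δ 0<δ) m n (l₃ p) (l₃ q)) (hB n (l₂ q))) ⟩
      A * δ + δ * B
        ≡⟨ solve 4 (λ a b e c → a :* (e :* c) :+ (e :* c) :* b := e :* (c :* (a :+ b)))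
             refl A B ε (1/ C) ⟩
      ε * (1/ C * C)   ≡⟨ cong (ε *_) (*-inverseˡ C) ⟩
      ε * 1ℚ           ≡⟨ *-identityʳ ε ⟩
      ε                ∎
      where
      open ≤-Reasoning
      open +-*-Solver
      l₁₂ : ∀ {i} → K ℕ.≤ i → Nᵃ ℕ.⊔ Nᵇ ℕ.≤ i
      l₁₂ = ℕ.m⊔n≤o⇒m≤o (Nᵃ ℕ.⊔ Nᵇ) (Mᵃ ℕ.⊔ Mᵇ)
      l₃₄ : ∀ {i} → K ℕ.≤ i → Mᵃ ℕ.⊔ Mᵇ ℕ.≤ i
      l₃₄ = ℕ.m⊔n≤o⇒n≤o (Nᵃ ℕ.⊔ Nᵇ) (Mᵃ ℕ.⊔ Mᵇ)
      l₁ : ∀ {i} → K ℕ.≤ i → Nᵃ ℕ.≤ i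
      l₁ p = ℕ.m⊔n≤o⇒m≤o Nᵃ Nᵇ (l₁₂ p)
      l₂ : ∀ {i} → K ℕ.≤ i → Nᵇ ℕ.≤ i
      l₂ p = ℕ.m⊔n≤o⇒n≤o Nᵃ Nᵇ (l₁₂ p)
      l₃ : ∀ {i} → K ℕ.≤ i → Mᵃ ℕ.≤ i
      l₃ p = ℕ.m⊔n≤o⇒m≤o Mᵃ Mᵇ (l₃₄ p)
      l₄ : ∀ {i} → K ℕ.≤ i → Mᵇ ℕ.≤ i
      l₄ p = ℕ.m⊔n≤o⇒n≤o Mᵃ Mᵇ (l₃₄ p)

open CauchyLemmas

fromℚ : ℚ → ℝ
fromℚ q = mkℝ (λ _ → q) (const-cauchy q)

fromℕ : ℕ → ℝ
fromℕ n = fromℚ (ι n)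

infixl 6 _+ᴿ_ _-ᴿ_
infixl 7 _*ᴿ_
infix  8 -ᴿ_
infixr 8 _^ᴿ_

_+ᴿ_ : ℝ → ℝ → ℝ
x +ᴿ y = mkℝ (λ n → seq x n + seq y n) (+-cauchy {seq x} {seq y} (cauchy x) (cauchy y))

_*ᴿ_ : ℝ → ℝ → ℝ
x *ᴿ y = mkℝ (λ n → seq x n * seq y n) (*-cauchy {seq x} {seq y} (cauchy x) (cauchy y))

-ᴿ_ : ℝ → ℝ
-ᴿ x = mkℝ (λ n → - seq x n) (neg-cauchy {seq x} (cauchy x))

_-ᴿ_ : ℝ → ℝ → ℝ
x -ᴿ y = x +ᴿ (-ᴿ y)

_^ᴿ_ : ℝ → ℕ → ℝ
x ^ᴿ zero  = fromℕ 1
x ^ᴿ suc n = x *ᴿ (x ^ᴿ n)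

-- ∑ᴿ n f = f 1 + f 2 + ⋯ + f n.

∑ᴿ : ℕ → (ℕ → ℝ) → ℝ
∑ᴿ zero    f = fromℕ 0
∑ᴿ (suc n) f = ∑ᴿ n f +ᴿ f (suc n)

AntitoneOn : ℚ → ℚ → (ℚ → ℚ) → Set
AntitoneOn a b f = ∀ {x y} → a ≤ x → x ≤ y → y ≤ b → f y ≤ f x

-- The Riemann sum of f over n equal pieces of [a , b], sampled at the right
-- endpoints a + j (b - a) / n.

riemann : (ℚ → ℚ) → ℚ → ℚ → ℕ → ℚ
riemann f a b n = ∑₁ n λ j → h * f (a + ι j * h)
  where h = (b - a) * recip n

module RiemannLemmas where
  module Riemann (f : ℚ → ℚ) (a b : ℚ) (a≤b : a ≤ b) (anti : AntitoneOn a b f) where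

    open +-*-Solver

    h : ℕ → ℚ
    h n = (b - a) * recip n

    x : ℕ → ℕ → ℚ
    x n j = a + ι j * h n

    right left : ℕ → ℚ
    right n = ∑₁ n λ j → h n * f (x n j)
    left  n = ∑₁ n λ j → h n * f (x n (pred j))

    0≤h : ∀ n → 0ℚ ≤ h n
    0≤h n = *-nonneg (p≤q⇒0≤q-p a≤b) (recip-nonneg n)

    x-end : ∀ n → x (suc n) (suc n) ≡ b
    x-end n = trans
      (solve 4 (λ a b i r → a :+ i :* ((b :- a) :* r) := a :+ (b :- a) :* (r :* i)) refl
        a b (ι (suc n)) (recip (suc n)))
      (trans (cong (λ t → a + (b - a) * t) (recip-inv n))
        (solve 2 (λ a b → a :+ (b :- a) :* con 1ℚ := b) refl a b))

    x-mono : ∀ n {i j} → i ℕ.≤ j → x n i ≤ x n j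
    x-mono n p = +-monoʳ-≤ a (*-mono-r (h n) (0≤h n) (ι-mono p))

    a≤x : ∀ n j → a ≤ x n j
    a≤x n j = ≤-+ʳ a (*-nonneg (ι-nonneg j) (0≤h n))

    f-anti : ∀ n {i j} → i ℕ.≤ j → j ℕ.≤ suc n → f (x (suc n) j) ≤ f (x (suc n) i)
    f-anti n {i} {j} p q = anti (a≤x (suc n) i) (x-mono (suc n) p)
      (subst (x (suc n) j ≤_) (x-end n) (x-mono (suc n) q))

    c : ℚ
    c = (b - a) * (f a - f b)

    0≤c : 0ℚ ≤ c
    0≤c = *-nonneg (p≤q⇒0≤q-p a≤b) (p≤q⇒0≤q-p (anti ≤-refl a≤b ≤-refl))

    left-right : ∀ n → left (suc n) ≡ right (suc n) + c * recip (suc n)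
    left-right n = trans (tele (suc n)) (cong (right (suc n) +_)
        (trans (cong₂ (λ s t → h (suc n) * (f s - f t)) x-zero (x-end n))
          (solve 3 (λ w r d → w :* r :* d := w :* d :* r) refl (b - a) (recip (suc n)) (f a - f b))))
      where
      x-zero : x (suc n) 0 ≡ a
      x-zero = trans (cong (a +_) (*-zeroˡ (h (suc n)))) (+-identityʳ a)
      tele : ∀ m → ∑₁ m (λ j → h (suc n) * f (x (suc n) (pred j)))
                 ≡ ∑₁ m (λ j → h (suc n) * f (x (suc n) j)) + h (suc n) * (f (x (suc n) 0) - f (x (suc n) m))
      tele zero    = solve 2 (λ h y → con 0ℚ := con 0ℚ :+ h :* (y :- y)) refl (h (suc n)) (f (x (suc n) 0))
      tele (suc m) = trans (cong (_+ h (suc n) * f (x (suc n) m)) (tele m))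
        (solve 5 (λ s h y z w → s :+ h :* (y :- z) :+ h :* z := s :+ h :* w :+ h :* (y :- w)) refl
          (∑₁ m (λ j → h (suc n) * f (x (suc n) j))) (h (suc n))
          (f (x (suc n) 0)) (f (x (suc n) m)) (f (x (suc n) (suc m))))

    ∑-split : ∀ p m g → ∑₁ (p ℕ.+ m) g ≡ ∑₁ p g + ∑₁ m (λ l → g (p ℕ.+ l))
    ∑-split p zero    g = trans (cong (λ k → ∑₁ k g) (ℕ.+-identityʳ p)) (sym (+-identityʳ (∑₁ p g)))
    ∑-split p (suc m) g = trans (cong (λ k → ∑₁ k g) (ℕ.+-suc p m))
      (trans (cong₂ _+_ (∑-split p m g) (cong g (sym (ℕ.+-suc p m))))
        (+-assoc (∑₁ p g) (∑₁ m (λ l → g (p ℕ.+ l))) (g (p ℕ.+ suc m))))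

    ∑-blocks : ∀ n m g → ∑₁ (n ℕ.* m) g ≡ ∑₁ n (λ i → ∑₁ m (λ l → g (pred i ℕ.* m ℕ.+ l)))
    ∑-blocks zero    m g = refl
    ∑-blocks (suc n) m g = trans (cong (λ k → ∑₁ k g) (ℕ.+-comm m (n ℕ.* m)))
      (trans (∑-split (n ℕ.* m) m g)
        (cong (_+ ∑₁ m (λ l → g (n ℕ.* m ℕ.+ l))) (∑-blocks n m g)))

    ∑-mono≤ : ∀ n {g k} → (∀ j → 1 ℕ.≤ j → j ℕ.≤ n → g j ≤ k j) → ∑₁ n g ≤ ∑₁ n k
    ∑-mono≤ zero    _ = ≤-refl
    ∑-mono≤ (suc n) p = +-mono-≤ (∑-mono≤ n λ j s t → p j s (ℕ.m≤n⇒m≤1+n t)) (p (suc n) (s≤s z≤n) ℕ.≤-refl)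

    ∑-const : ∀ n t → ∑₁ n (λ _ → t) ≡ ι n * t
    ∑-const zero    t = sym (*-zeroˡ t)
    ∑-const (suc n) t = trans (cong (_+ t) (∑-const n t))
      (trans (solve 2 (λ i t → i :* t :+ t := (i :+ con 1ℚ) :* t) refl (ι n) t)
        (cong (_* t) (sym (ι-suc n))))

    module Refine (n m : ℕ) where
      nm = suc n ℕ.* suc m

      h-refine : ι (suc m) * h nm ≡ h (suc n)
      h-refine = begin
        M * (w * r)                   ≡⟨ solve 3 (λ M w r → M :* (w :* r) := w :* (r :* M) :* con 1ℚ) refl M w r ⟩
        w * (r * M) * 1ℚ              ≡⟨ cong (w * (r * M) *_) (sym (recip-inv n)) ⟩
        w * (r * M) * (s * N)         ≡⟨ solve 5 (λ M w r s N → w :* (r :* M) :* (s :* N) := w :* s :* (r :* (N :* M))) refl M w r s N ⟩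
        w * s * (r * (N * M))         ≡⟨ cong (λ t → w * s * (r * t)) (sym (ι-* (suc n) (suc m))) ⟩
        w * s * (r * ι nm)            ≡⟨ cong (w * s *_) (recip-inv (m ℕ.+ n ℕ.* suc m)) ⟩
        w * s * 1ℚ                    ≡⟨ *-identityʳ (w * s) ⟩
        w * s                         ∎
        where
        open Relation.Binary.PropositionalEquality.≡-Reasoning
        M w r s N : ℚ
        M = ι (suc m) ; w = b - a ; r = recip nm ; s = recip (suc n) ; N = ι (suc n)

      x-refine : ∀ i → x nm (i ℕ.* suc m) ≡ x (suc n) i
      x-refine i = cong (a +_) (trans (cong (_* h nm) (ι-* i (suc m)))
        (trans (*-assoc (ι i) (ι (suc m)) (h nm)) (cong (ι i *_) h-refine)))

      block : ∀ i → h (suc n) * f (x (suc n) i) ≡ ∑₁ (suc m) (λ _ → h nm * f (x nm (i ℕ.* suc m)))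
      block i = sym (trans (∑-const (suc m) _) (trans (sym (*-assoc (ι (suc m)) (h nm) _))
        (cong₂ _*_ h-refine (cong f (x-refine i)))))

      end≤ : ∀ i {l} → suc i ℕ.≤ suc n → l ℕ.≤ suc m → i ℕ.* suc m ℕ.+ l ℕ.≤ suc i ℕ.* suc m
      end≤ i {l} _ q = subst (i ℕ.* suc m ℕ.+ l ℕ.≤_) (ℕ.+-comm (i ℕ.* suc m) (suc m)) (ℕ.+-monoʳ-≤ (i ℕ.* suc m) q)

      right-refine : right (suc n) ≤ right nm
      right-refine = subst (right (suc n) ≤_) (sym (∑-blocks (suc n) (suc m) _))
        (∑-mono≤ (suc n) λ { (suc i) _ p → subst (_≤ ∑₁ (suc m) (λ l → h nm * f (x nm (i ℕ.* suc m ℕ.+ l)))) (sym (block (suc i)))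
          (∑-mono≤ (suc m) λ l _ q → *-mono-l (h nm) (0≤h nm)
            (f-anti _ (end≤ i p q) (ℕ.*-monoˡ-≤ (suc m) p))) })

      left-refine : left nm ≤ left (suc n)
      left-refine = subst (_≤ left (suc n)) (sym (∑-blocks (suc n) (suc m) _))
        (∑-mono≤ (suc n) λ { (suc i) _ p → subst (∑₁ (suc m) (λ l → h nm * f (x nm (pred (i ℕ.* suc m ℕ.+ l)))) ≤_) (sym (block i))
          (∑-mono≤ (suc m) λ { (suc l) _ q → *-mono-l (h nm) (0≤h nm)
            (subst (λ k → f (x nm (pred k)) ≤ f (x nm (i ℕ.* suc m))) (sym (ℕ.+-suc (i ℕ.* suc m) l))
              (f-anti _ (ℕ.m≤m+n (i ℕ.* suc m) l)
                (ℕ.≤-trans (end≤ i p (ℕ.<⇒≤ q)) (ℕ.*-monoˡ-≤ (suc m) p)))) }) })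

    right≤left : ∀ n → right (suc n) ≤ left (suc n)
    right≤left n = subst (right (suc n) ≤_) (sym (left-right n))
      (≤-+ʳ (right (suc n)) (*-nonneg 0≤c (recip-nonneg (suc n))))

    right≤ : ∀ n m → right (suc n) ≤ right (suc m) + c * recip (suc m)
    right≤ n m = begin
      right (suc n)                     ≤⟨ Refine.right-refine n m ⟩
      right (suc n ℕ.* suc m)           ≤⟨ right≤left (m ℕ.+ n ℕ.* suc m) ⟩
      left (suc n ℕ.* suc m)            ≡⟨ cong left (ℕ.*-comm (suc n) (suc m)) ⟩
      left (suc m ℕ.* suc n)            ≤⟨ Refine.left-refine m n ⟩
      left (suc m)                      ≡⟨ left-right m ⟩
      right (suc m) + c * recip (suc m) ∎
      where open ≤-Reasoning

    riemann-cauchy : IsCauchy (riemann f a b)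
    riemann-cauchy ε 0<ε with archimedean c 0<ε
    ... | N , c≤Nε = suc N , bound
      where
      small : ∀ m → N ℕ.≤ m → c * recip (suc m) ≤ ε
      small m p = subst (c * recip (suc m) ≤_) lem (*-mono-r (recip (suc m)) (recip-nonneg (suc m))
        (≤-trans c≤Nε (*-mono-r ε (<⇒≤ 0<ε) (ι-mono (ℕ.m≤n⇒m≤1+n p)))))
        where
        lem : ι (suc m) * ε * recip (suc m) ≡ ε
        lem = trans (solve 3 (λ i e r → i :* e :* r := e :* (r :* i)) refl (ι (suc m)) ε (recip (suc m)))
          (trans (cong (ε *_) (recip-inv m)) (*-identityʳ ε))
      diff : ∀ n m → N ℕ.≤ m → right (suc n) - right (suc m) ≤ ε
      diff n m p = ≤-trans (+-monoˡ-≤ (- right (suc m)) (right≤ n m))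
        (subst (_≤ ε) (solve 2 (λ r c → c := r :+ c :- r) refl (right (suc m)) (c * recip (suc m))) (small m p))
      bound : ∀ m n → suc N ℕ.≤ m → suc N ℕ.≤ n → ∣ right m - right n ∣ ≤ ε
      bound (suc m) (suc n) (s≤s p) (s≤s q) = ∣ right (suc m) - right (suc n) ∣≤ (diff m n q)
        (subst (_≤ ε) (solve 2 (λ s t → s :- t := :- (t :- s)) refl (right (suc n)) (right (suc m))) (diff n m p))

open RiemannLemmas

integral : (f : ℚ → ℚ) (a b : ℚ) → a ≤ b → AntitoneOn a b f → ℝ
integral f a b a≤b anti = mkℝ (riemann f a b) (Riemann.riemann-cauchy f a b a≤b anti)

module ReciprocalLemmas where

  inv-* : ∀ {q} → 0ℚ < q → inv q * q ≡ 1ℚ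
  inv-* {q} 0<q with q ≟ 0ℚ
  ... | yes q≡0 = contradiction 0<q (<-irrefl (sym q≡0))
  ... | no  q≢0 = *-inverseˡ q {{≢-nonZero q≢0}}

  inv-nonneg : ∀ {q} → 0ℚ < q → 0ℚ ≤ inv q
  inv-nonneg {q} 0<q with q ≟ 0ℚ
  ... | yes q≡0 = ≤-refl
  ... | no  q≢0 = <⇒≤ (positive⁻¹ _ {{1/pos⇒pos q {{positive 0<q}}}})

  inv-antitone : ∀ b → AntitoneOn 1ℚ b inv
  inv-antitone b {x} {y} 1≤x x≤y _ = begin
    inv y              ≡⟨ sym (*-identityʳ (inv y)) ⟩
    inv y * 1ℚ         ≡⟨ cong (inv y *_) (sym (trans (*-comm x (inv x)) (inv-* 0<x))) ⟩
    inv y * (x * inv x) ≤⟨ *-mono-l (inv y) (inv-nonneg 0<y) (*-mono-r (inv x) (inv-nonneg 0<x) x≤y) ⟩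
    inv y * (y * inv x) ≡⟨ sym (*-assoc (inv y) y (inv x)) ⟩
    inv y * y * inv x  ≡⟨ cong (_* inv x) (inv-* 0<y) ⟩
    1ℚ * inv x         ≡⟨ *-identityˡ (inv x) ⟩
    inv x              ∎
    where
    open ≤-Reasoning
    0<x = <-≤-trans 0<1 1≤x
    0<y = <-≤-trans 0<x x≤y

open ReciprocalLemmas

-- ln y = ∫₁^y dt/t

ln : (y : ℚ) {_ : True (1ℚ ≤? y)} → ℝ
ln y {1≤y} = integral inv 1ℚ y (toWitness 1≤y) (inv-antitone y)

-- truncated (s₂ ∷ ⋯ ∷ sᵣ ∷ []) n = ∑_{n ≥ k₂ > ⋯ > kᵣ ≥ 1} 1 / (k₂^s₂ ⋯ kᵣ^sᵣ)

truncated : List ℕ → ℕ → ℚ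
truncated []       n = 1ℚ
truncated (s ∷ ss) n = ∑₁ n λ k → recip k ^ s * truncated ss (pred k)

-- The k₁-th summand of ζ(s , ss ; x), the inner sum running over k₁ > k₂.

ζ-summand : ℕ → List ℕ → ℚ → ℕ → ℚ
ζ-summand s ss x k = x ^ k * (recip k ^ s * truncated ss (pred k))

Li-summand : ℕ → ℚ → ℕ → ℚ
Li-summand p x n = x ^ n * recip n ^ p

module SeriesLemmas where

  1^n : ∀ n → 1ℚ ^ n ≡ 1ℚ
  1^n zero    = refl
  1^n (suc n) = trans (*-identityˡ (1ℚ ^ n)) (1^n n)

  Tends0 : (ℕ → ℚ) → Set
  Tends0 F = ∀ ε → 0ℚ < ε → ∃[ N ] (∀ n → N ℕ.≤ n → F n ≤ ε)

  -- a series dominated by a telescoping one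
  telescope-cauchy : ∀ {a F : ℕ → ℚ} → (∀ n → 0ℚ ≤ F n) → Tends0 F →
    (∀ n → ∣ a (suc (suc n)) ∣ ≤ F (suc n) - F (suc (suc n))) → IsCauchy (λ n → ∑₁ n a)
  telescope-cauchy {a} {F} 0≤F F→0 dom ε 0<ε with F→0 ε 0<ε
  ... | N , small = suc N , bound
    where
    open +-*-Solver
    S : ℕ → ℚ
    S n = ∑₁ n a
    tail : ∀ d m → ∣ S (d ℕ.+ suc m) - S (suc m) ∣ ≤ F (suc m) - F (d ℕ.+ suc m)
    tail zero    m = ≤-reflexive (trans (cong ∣_∣ (+-inverseʳ (S (suc m)))) (sym (+-inverseʳ (F (suc m)))))
    tail (suc d) m = begin
      ∣ S k + a (suc k) - S (suc m) ∣
        ≡⟨ cong ∣_∣ (solve 3 (λ s a t → s :+ a :- t := (s :- t) :+ a) refl (S k) (a (suc k)) (S (suc m))) ⟩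
      ∣ (S k - S (suc m)) + a (suc k) ∣          ≤⟨ ∣p+q∣≤∣p∣+∣q∣ (S k - S (suc m)) (a (suc k)) ⟩
      ∣ S k - S (suc m) ∣ + ∣ a (suc k) ∣        ≤⟨ +-mono-≤ (tail d m) (dom′ k (ℕ.m≤n+m (suc m) d)) ⟩
      (F (suc m) - F k) + (F k - F (suc k))
        ≡⟨ solve 3 (λ x y z → (x :- y) :+ (y :- z) := x :- z) refl (F (suc m)) (F k) (F (suc k)) ⟩
      F (suc m) - F (suc k)                      ∎
      where
      open ≤-Reasoning
      k = d ℕ.+ suc m
      dom′ : ∀ k → suc m ℕ.≤ k → ∣ a (suc k) ∣ ≤ F k - F (suc k)
      dom′ (suc k) _ = dom k
    later : ∀ m n → suc N ℕ.≤ m → m ℕ.≤ n → ∣ S n - S m ∣ ≤ ε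
    later (suc m) n p q = subst (λ k → ∣ S k - S (suc m) ∣ ≤ ε) (ℕ.m∸n+n≡m q)
      (≤-trans (tail (n ℕ.∸ suc m) m)
        (≤-trans (p-q≤p (F (suc m)) (0≤F (n ℕ.∸ suc m ℕ.+ suc m))) (small (suc m) (ℕ.<⇒≤ p))))
    bound : ∀ m n → suc N ℕ.≤ m → suc N ℕ.≤ n → ∣ S m - S n ∣ ≤ ε
    bound m n p q with ℕ.≤-total m n
    ... | inj₁ m≤n = subst (_≤ ε) (∣p-q∣≡∣q-p∣ (S n) (S m)) (later m n p m≤n)
    ... | inj₂ n≤m = later n m q n≤m

  truncated-nonneg : ∀ ss n → 0ℚ ≤ truncated ss n
  truncated-nonneg []       n = 0≤1
  truncated-nonneg (s ∷ ss) n = ∑-nonneg n λ k →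
    *-nonneg (^-nonneg s (recip-nonneg k)) (truncated-nonneg ss (pred k))

  H : ℕ → ℕ → ℚ
  H r = truncated (replicate r 1)

  truncated≤H : ∀ {ss} → All ℕ.NonZero ss → ∀ n → truncated ss n ≤ H (length ss) n
  truncated≤H []              n = ≤-refl
  truncated≤H {s ∷ ss} (p ∷ ps) n = ∑-mono n λ k → *-mono
    (^-nonneg s (recip-nonneg k)) (truncated-nonneg (replicate (length ss) 1) (pred k))
    (^-anti (recip-nonneg k) (recip≤1 k) (ℕ.>-nonZero⁻¹ s {{p}})) (truncated≤H ps (pred k))

  H-small-step : ∀ r δ → 0ℚ ≤ δ → ∀ N → (∀ n → N ℕ.≤ n → H r n ≤ ι n * δ) →
    ∀ d → H (suc r) (d ℕ.+ N) ≤ H (suc r) N + ι d * δ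
  H-small-step r δ 0≤δ N h zero    = ≤-+ʳ (H (suc r) N) (*-nonneg {ι 0} {δ} ≤-refl 0≤δ)
  H-small-step r δ 0≤δ N h (suc d) = begin
    H (suc r) k + recip (suc k) * 1ℚ * H r k
      ≤⟨ +-mono-≤ (H-small-step r δ 0≤δ N h d) step ⟩
    (H (suc r) N + ι d * δ) + δ
      ≡⟨ solve 3 (λ x i e → (x :+ i :* e) :+ e := x :+ (i :+ con 1ℚ) :* e) refl (H (suc r) N) (ι d) δ ⟩
    H (suc r) N + (ι d + 1ℚ) * δ
      ≡⟨ cong (λ t → H (suc r) N + t * δ) (sym (ι-suc d)) ⟩
    H (suc r) N + ι (suc d) * δ  ∎
    where
    open ≤-Reasoning
    open +-*-Solver
    k = d ℕ.+ N
    step : recip (suc k) * 1ℚ * H r k ≤ δ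
    step = begin
      recip (suc k) * 1ℚ * H r k          ≡⟨ cong (_* H r k) (*-identityʳ (recip (suc k))) ⟩
      recip (suc k) * H r k
        ≤⟨ *-mono-l (recip (suc k)) (recip-nonneg (suc k))
             (≤-trans (h k (ℕ.m≤n+m N d)) (*-mono-r δ 0≤δ (ι-mono (ℕ.n≤1+n k)))) ⟩
      recip (suc k) * (ι (suc k) * δ)     ≡⟨ sym (*-assoc (recip (suc k)) (ι (suc k)) δ) ⟩
      recip (suc k) * ι (suc k) * δ       ≡⟨ cong (_* δ) (recip-inv k) ⟩
      1ℚ * δ                              ≡⟨ *-identityˡ δ ⟩
      δ                                   ∎

  -- H r n / n → 0, by repeated Cesàro averaging
  H-small : ∀ r ε → 0ℚ < ε → ∃[ N ] (∀ n → N ℕ.≤ n → H r n ≤ ι n * ε)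
  H-small-suc : ∀ r ε δ → 0ℚ < δ → δ + δ ≡ ε → ∃[ N ] (∀ n → N ℕ.≤ n → H (suc r) n ≤ ι n * ε)
  H-small zero    ε 0<ε = proj₁ arch , λ n p → ≤-trans (proj₂ arch) (*-mono-r ε (<⇒≤ 0<ε) (ι-mono p))
    where arch = archimedean 1ℚ 0<ε
  H-small (suc r) ε 0<ε = H-small-suc r ε (½ * ε) (half-pos 0<ε) (half+half ε)
  H-small-suc r ε δ 0<δ δ+δ≡ε = N ℕ.+ M , bound
    where
    open ≤-Reasoning
    ih = H-small r δ 0<δ
    N = proj₁ ih
    arch = archimedean (H (suc r) N) 0<δ
    M = proj₁ arch
    0≤δ = <⇒≤ 0<δ
    bound : ∀ n → N ℕ.+ M ℕ.≤ n → H (suc r) n ≤ ι n * ε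
    bound n p = begin
      H (suc r) n                   ≡⟨ cong (H (suc r)) (sym (ℕ.m∸n+n≡m (ℕ.≤-trans (ℕ.m≤m+n N M) p))) ⟩
      H (suc r) (n ℕ.∸ N ℕ.+ N)     ≤⟨ H-small-step r δ 0≤δ N (proj₂ ih) (n ℕ.∸ N) ⟩
      H (suc r) N + ι (n ℕ.∸ N) * δ
        ≤⟨ +-mono-≤ (≤-trans (proj₂ arch) (*-mono-r δ 0≤δ (ι-mono (ℕ.≤-trans (ℕ.m≤n+m M N) p))))
                    (*-mono-r δ 0≤δ (ι-mono (ℕ.m∸n≤m n N))) ⟩
      ι n * δ + ι n * δ             ≡⟨ sym (*-distribˡ-+ (ι n) δ δ) ⟩
      ι n * (δ + δ)                 ≡⟨ cong (ι n *_) δ+δ≡ε ⟩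
      ι n * ε                       ∎

  G : ℕ → ℕ → ℚ
  G zero    n = H zero n * recip n
  G (suc r) n = G r n + H (suc r) n * recip n

  H-quot : ∀ r → Tends0 (λ n → H r n * recip n)
  H-quot r ε 0<ε with H-small r ε 0<ε
  ... | N , h = suc N , λ { (suc n) (s≤s p) → begin
    H r (suc n) * recip (suc n)           ≤⟨ *-mono-r (recip (suc n)) (recip-nonneg (suc n)) (h (suc n) (ℕ.m≤n⇒m≤1+n p)) ⟩
    ι (suc n) * ε * recip (suc n)
      ≡⟨ solve 3 (λ i e r → i :* e :* r := e :* (r :* i)) refl (ι (suc n)) ε (recip (suc n)) ⟩
    ε * (recip (suc n) * ι (suc n))       ≡⟨ cong (ε *_) (recip-inv n) ⟩
    ε * 1ℚ                                ≡⟨ *-identityʳ ε ⟩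
    ε                                     ∎ }
    where open ≤-Reasoning
          open +-*-Solver

  G→0 : ∀ r → Tends0 (G r)
  G→0-suc : ∀ r ε δ → 0ℚ < δ → δ + δ ≡ ε → ∃[ N ] (∀ n → N ℕ.≤ n → G (suc r) n ≤ ε)
  G→0 zero    = H-quot zero
  G→0 (suc r) ε 0<ε = G→0-suc r ε (½ * ε) (half-pos 0<ε) (half+half ε)
  G→0-suc r ε δ 0<δ δ+δ≡ε = M ℕ.⊔ N , λ n p → ≤-trans
    (+-mono-≤ (proj₂ (G→0 r δ 0<δ) n (ℕ.m⊔n≤o⇒m≤o M N p))
              (proj₂ (H-quot (suc r) δ 0<δ) n (ℕ.m⊔n≤o⇒n≤o M N p)))
    (≤-reflexive δ+δ≡ε)
    where
    M = proj₁ (G→0 r δ 0<δ)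
    N = proj₁ (H-quot (suc r) δ 0<δ)

  H-quot-nonneg : ∀ r n → 0ℚ ≤ H r n * recip n
  H-quot-nonneg r n = *-nonneg (truncated-nonneg (replicate r 1) n) (recip-nonneg n)

  G-nonneg : ∀ r n → 0ℚ ≤ G r n
  G-nonneg zero    n = H-quot-nonneg zero n
  G-nonneg (suc r) n = +-nonneg (G-nonneg r n) (H-quot-nonneg (suc r) n)

  G-step : ∀ r n → recip (suc (suc n)) * recip (suc (suc n)) * H r (suc n) ≤ G r (suc n) - G r (suc (suc n))
  G-step r n = go r
    where
    open ≤-Reasoning
    open +-*-Solver
    u v : ℚ
    u = recip (suc (suc n)) ; v = recip (suc n)
    uu≤v-u : u * u ≤ v - u
    uu≤v-u = subst (u * u ≤_) (sym (recip-diff n)) (*-mono-r u (recip-nonneg (suc (suc n))) (recip-anti n))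
    go : ∀ r → u * u * H r (suc n) ≤ G r (suc n) - G r (suc (suc n))
    go zero    = begin
      u * u * 1ℚ           ≡⟨ *-identityʳ (u * u) ⟩
      u * u                ≤⟨ uu≤v-u ⟩
      v - u                ≡⟨ solve 2 (λ u v → v :- u := con 1ℚ :* v :- con 1ℚ :* u) refl u v ⟩
      1ℚ * v - 1ℚ * u      ∎
    go (suc r) = begin
      u * u * A
        ≤⟨ *-mono-r A (truncated-nonneg (replicate (suc r) 1) (suc n)) uu≤v-u ⟩
      (v - u) * A
        ≡⟨ solve 4 (λ u v A B → (v :- u) :* A := u :* u :* B :+ (A :* v :- (A :+ u :* con 1ℚ :* B) :* u)) refl u v A B ⟩
      u * u * B + (A * v - (A + u * 1ℚ * B) * u)
        ≤⟨ +-monoˡ-≤ _ (go r) ⟩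
      (g - g′) + (A * v - A′ * u)
        ≡⟨ solve 4 (λ g g′ x y → (g :- g′) :+ (x :- y) := (g :+ x) :- (g′ :+ y)) refl g g′ (A * v) (A′ * u) ⟩
      (g + A * v) - (g′ + A′ * u) ∎
      where
      A A′ B g g′ : ℚ
      A = H (suc r) (suc n) ; A′ = H (suc r) (suc (suc n)) ; B = H r (suc n)
      g = G r (suc n) ; g′ = G r (suc (suc n))

  ζ-cauchy : ∀ s ss → .{{ℕ.NonTrivial s}} → All ℕ.NonZero ss → IsCauchy (λ n → ∑₁ n (ζ-summand s ss 1ℚ))
  ζ-cauchy s ss {{nt}} ps = telescope-cauchy (G-nonneg r) (G→0 r) dom
    where
    r = length ss
    dom : ∀ n → ∣ ζ-summand s ss 1ℚ (suc (suc n)) ∣ ≤ G r (suc n) - G r (suc (suc n))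
    dom n = begin
      ∣ 1ℚ ^ suc (suc n) * t ∣          ≡⟨ cong (λ w → ∣ w * t ∣) (1^n (suc (suc n))) ⟩
      ∣ 1ℚ * t ∣                        ≡⟨ cong ∣_∣ (*-identityˡ t) ⟩
      ∣ t ∣                             ≡⟨ 0≤p⇒∣p∣≡p (*-nonneg (^-nonneg s 0≤u) (truncated-nonneg ss (suc n))) ⟩
      u ^ s * truncated ss (suc n)
        ≤⟨ *-mono (^-nonneg s 0≤u) (truncated-nonneg (replicate r 1) (suc n))
             (^-anti 0≤u (recip≤1 (suc (suc n))) (ℕ.nonTrivial⇒n>1 s {{nt}})) (truncated≤H ps (suc n)) ⟩
      u ^ 2 * H r (suc n)               ≡⟨ cong (λ w → u * w * H r (suc n)) (*-identityʳ u) ⟩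
      u * u * H r (suc n)               ≤⟨ G-step r n ⟩
      G r (suc n) - G r (suc (suc n))   ∎
      where
      open ≤-Reasoning
      u t : ℚ
      u = recip (suc (suc n))
      t = u ^ s * truncated ss (suc n)
      0≤u = recip-nonneg (suc (suc n))

  module Geometric (q d e : ℚ) (0≤q : 0ℚ ≤ q) (0<d : 0ℚ < d) (q≡1-d : q ≡ 1ℚ - d)
                   (0≤e : 0ℚ ≤ e) (e*d≡1 : e * d ≡ 1ℚ) where
    open +-*-Solver

    bernoulli : ∀ n → q ^ n * (1ℚ + ι n * d) ≤ 1ℚ
    bernoulli zero    = ≤-reflexive (solve 1 (λ d → con 1ℚ :* (con 1ℚ :+ con 0ℚ :* d) := con 1ℚ) refl d)
    bernoulli (suc n) = begin
      q * q ^ n * (1ℚ + ι (suc n) * d)      ≡⟨ cong (λ i → q * q ^ n * (1ℚ + i * d)) (ι-suc n) ⟩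
      q * q ^ n * (1ℚ + (ι n + 1ℚ) * d)
        ≡⟨ cong (λ t → t * q ^ n * (1ℚ + (ι n + 1ℚ) * d)) q≡1-d ⟩
      (1ℚ - d) * q ^ n * (1ℚ + (ι n + 1ℚ) * d)
        ≡⟨ solve 3 (λ d p i → (con 1ℚ :- d) :* p :* (con 1ℚ :+ (i :+ con 1ℚ) :* d)
                    := p :* ((con 1ℚ :+ i :* d) :- (i :+ con 1ℚ) :* (d :* d)))
             refl d (q ^ n) (ι n) ⟩
      q ^ n * ((1ℚ + ι n * d) - (ι n + 1ℚ) * (d * d))
        ≤⟨ *-mono-l (q ^ n) (^-nonneg n 0≤q) (p-q≤p (1ℚ + ι n * d)
             (*-nonneg (+-nonneg (ι-nonneg n) 0≤1) (*-nonneg (<⇒≤ 0<d) (<⇒≤ 0<d)))) ⟩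
      q ^ n * (1ℚ + ι n * d)                ≤⟨ bernoulli n ⟩
      1ℚ                                    ∎
      where open ≤-Reasoning

    q^→0 : Tends0 (q ^_)
    q^→0 ε 0<ε = suc N , bound
      where
      open ≤-Reasoning
      0<dε : 0ℚ < d * ε
      0<dε = *-pos {d} {ε} 0<d 0<ε
      arch : ∃[ N ] 1ℚ ≤ ι N * (d * ε)
      arch = archimedean 1ℚ 0<dε
      N : ℕ
      N = proj₁ arch
      lem : ∀ n → N ℕ.≤ suc n → q ^ suc n * (ι (suc n) * d) ≤ ε * (ι (suc n) * d)
      lem n p = begin
        q ^ suc n * (ι (suc n) * d)         ≤⟨ *-mono-l (q ^ suc n) (^-nonneg (suc n) 0≤q) (≤-+ˡ (ι (suc n) * d) 0≤1) ⟩
        q ^ suc n * (1ℚ + ι (suc n) * d)    ≤⟨ bernoulli (suc n) ⟩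
        1ℚ                                  ≤⟨ proj₂ arch ⟩
        ι N * (d * ε)                       ≤⟨ *-mono-r (d * ε) (<⇒≤ 0<dε) (ι-mono p) ⟩
        ι (suc n) * (d * ε)                 ≡⟨ solve 3 (λ i d e → i :* (d :* e) := e :* (i :* d)) refl (ι (suc n)) d ε ⟩
        ε * (ι (suc n) * d)                 ∎
      bound : ∀ n → suc N ℕ.≤ n → q ^ n ≤ ε
      bound (suc n) (s≤s p) =
        *-cancelʳ-≤-pos {q ^ suc n} {ε} (ι (suc n) * d) {{positive (*-pos {ι (suc n)} {d} (ι-pos n) 0<d)}}
          (lem n (ℕ.m≤n⇒m≤1+n p))

    F : ℕ → ℚ
    F n = q ^ suc n * e

    F→0 : Tends0 F
    F→0 ε 0<ε = proj₁ small , λ n p → begin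
      q ^ suc n * e      ≤⟨ *-mono-r e 0≤e (proj₂ small (suc n) (ℕ.m≤n⇒m≤1+n p)) ⟩
      ε * d * e          ≡⟨ trans (*-assoc ε d e) (cong (ε *_) (trans (*-comm d e) e*d≡1)) ⟩
      ε * 1ℚ             ≡⟨ *-identityʳ ε ⟩
      ε                  ∎
      where
      open ≤-Reasoning
      small : ∃[ N ] (∀ n → N ℕ.≤ n → q ^ n ≤ ε * d)
      small = q^→0 (ε * d) (*-pos {ε} {d} 0<ε 0<d)

    F-step : ∀ n → F n - F (suc n) ≡ q ^ suc n
    F-step n = begin
      p * e - q * p * e               ≡⟨ cong (λ t → p * e - t * p * e) q≡1-d ⟩
      p * e - (1ℚ - d) * p * e        ≡⟨ solve 3 (λ d p e → p :* e :- (con 1ℚ :- d) :* p :* e := p :* (e :* d)) refl d p e ⟩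
      p * (e * d)                     ≡⟨ cong (p *_) e*d≡1 ⟩
      p * 1ℚ                          ≡⟨ *-identityʳ p ⟩
      p                               ∎
      where
      open Relation.Binary.PropositionalEquality.≡-Reasoning
      p : ℚ
      p = q ^ suc n

  power-cauchy : ∀ {x} (b : ℕ → ℚ) → ∣ x ∣ < 1ℚ → (∀ n → 0ℚ ≤ b (suc n)) → (∀ n → b (suc n) ≤ 1ℚ) →
    IsCauchy (λ n → ∑₁ n (λ k → x ^ k * b k))
  power-cauchy {x} b x<1 0≤b b≤1 = telescope-cauchy
    (λ n → *-nonneg (^-nonneg (suc n) 0≤q) (inv-nonneg 0<d)) F→0 dom
    where
    q = ∣ x ∣
    0≤q = 0≤∣p∣ x
    0<d : 0ℚ < 1ℚ - q
    0<d = p<q⇒0<q-p x<1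
    q≡1-d : q ≡ 1ℚ - (1ℚ - q)
    q≡1-d = solve 1 (λ q → q := con 1ℚ :- (con 1ℚ :- q)) refl q
      where open +-*-Solver
    open Geometric q (1ℚ - q) (inv (1ℚ - q)) 0≤q 0<d q≡1-d (inv-nonneg 0<d) (inv-* 0<d)
    dom : ∀ n → ∣ x ^ suc (suc n) * b (suc (suc n)) ∣ ≤ F (suc n) - F (suc (suc n))
    dom n = begin
      ∣ x ^ suc (suc n) * b (suc (suc n)) ∣        ≡⟨ ∣p*q∣≡∣p∣*∣q∣ (x ^ suc (suc n)) (b (suc (suc n))) ⟩
      ∣ x ^ suc (suc n) ∣ * ∣ b (suc (suc n)) ∣    ≡⟨ cong₂ _*_ (∣^∣ x (suc (suc n))) (0≤p⇒∣p∣≡p (0≤b (suc n))) ⟩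
      q ^ suc (suc n) * b (suc (suc n))            ≤⟨ *-mono-l (q ^ suc (suc n)) (^-nonneg (suc (suc n)) 0≤q) (b≤1 (suc n)) ⟩
      q ^ suc (suc n) * 1ℚ                         ≡⟨ *-identityʳ (q ^ suc (suc n)) ⟩
      q ^ suc (suc n)                              ≡⟨ sym (F-step (suc n)) ⟩
      F (suc n) - F (suc (suc n))                  ∎
      where open ≤-Reasoning

  H≤ : ∀ r n → H r n ≤ ι (suc n)
  H≤ zero    n       = 1≤ι-suc n
  H≤ (suc r) zero    = 0≤1
  H≤ (suc r) (suc n) = subst (H (suc r) (suc n) ≤_) (sym (ι-suc (suc n)))
    (+-mono-≤ (H≤ (suc r) n) (begin
      recip (suc n) * 1ℚ * H r n     ≡⟨ cong (_* H r n) (*-identityʳ (recip (suc n))) ⟩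
      recip (suc n) * H r n          ≤⟨ *-mono-l (recip (suc n)) (recip-nonneg (suc n)) (H≤ r n) ⟩
      recip (suc n) * ι (suc n)      ≡⟨ recip-inv n ⟩
      1ℚ                             ∎))
    where open ≤-Reasoning

  ζₓ-cauchy : ∀ s ss {x} → .{{ℕ.NonZero s}} → All ℕ.NonZero ss → ∣ x ∣ < 1ℚ →
    IsCauchy (λ n → ∑₁ n (ζ-summand s ss x))
  ζₓ-cauchy s ss {{nz}} ps x<1 = power-cauchy (λ k → recip k ^ s * truncated ss (pred k)) x<1
    (λ n → *-nonneg (^-nonneg s (recip-nonneg (suc n))) (truncated-nonneg ss n))
    λ n → begin
      recip (suc n) ^ s * truncated ss n
        ≤⟨ *-mono (^-nonneg s (recip-nonneg (suc n))) (ι-nonneg (suc n))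
             (^-anti (recip-nonneg (suc n)) (recip≤1 (suc n)) (ℕ.>-nonZero⁻¹ s {{nz}}))
             (≤-trans (truncated≤H ps n) (H≤ (length ss) n)) ⟩
      recip (suc n) * 1ℚ * ι (suc n)   ≡⟨ cong (_* ι (suc n)) (*-identityʳ (recip (suc n))) ⟩
      recip (suc n) * ι (suc n)        ≡⟨ recip-inv n ⟩
      1ℚ                               ∎
    where open ≤-Reasoning

  Li-cauchy : ∀ p {x} → ∣ x ∣ < 1ℚ → IsCauchy (λ n → ∑₁ n (Li-summand p x))
  Li-cauchy p x<1 = power-cauchy (λ k → recip k ^ p) x<1
    (λ n → ^-nonneg p (recip-nonneg (suc n)))
    (λ n → ^-anti {n = p} (recip-nonneg (suc n)) (recip≤1 (suc n)) z≤n)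

open SeriesLemmas

-- ζ(s , ss) for positive exponents with s ≥ 2.

ζ : (s : ℕ) (ss : List ℕ) .{{_ : ℕ.NonTrivial s}} {{_ : All ℕ.NonZero ss}} → ℝ
ζ s ss {{s≥2}} {{ps}} = mkℝ (λ n → ∑₁ n (ζ-summand s ss 1ℚ)) (ζ-cauchy s ss {{s≥2}} ps)

-- ζ(s , ss ; x) for positive exponents; only rational x with ∣ x ∣ < 1 is
-- covered, where every such series converges absolutely.

ζ[_,_⨾_] : (s : ℕ) (ss : List ℕ) (x : ℚ) .{{_ : ℕ.NonZero s}} {{_ : All ℕ.NonZero ss}}
           {_ : True (∣ x ∣ <? 1ℚ)} → ℝ
ζ[ s , ss ⨾ x ] {{s≥1}} {{ps}} {x<1} =
  mkℝ (λ n → ∑₁ n (ζ-summand s ss x)) (ζₓ-cauchy s ss {{s≥1}} ps (toWitness x<1))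

Li : (p : ℕ) (x : ℚ) {_ : True (∣ x ∣ <? 1ℚ)} → ℝ
Li p x {x<1} = mkℝ (λ n → ∑₁ n (Li-summand p x)) (Li-cauchy p (toWitness x<1))

instance
  replicate-1-nonZero : ∀ {r} → All ℕ.NonZero (replicate r 1)
  replicate-1-nonZero {zero}  = []
  replicate-1-nonZero {suc r} = ℕ.nonZero ∷ replicate-1-nonZero {r}

{-# OPTIONS --safe #-}
-- With x = ½, integration by parts of ∫ₓ¹ ζ({1}_r; t) (1 - t)ᵐ dt, summed over m, gives
-- the path composition formula
--   ζ(2,{1}_{i-1}) - ζ(2,{1}_{i-1}; ½) = ∑_{j=0}^{i} ζ({1}_{i-j}; ½) Li_{j+1}(½).
-- Since r! ζ({1}_r; ½) = (ln 2)ʳ, i! times the left-hand side is the binomial transform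
-- of j ↦ j! Li_{j+1}(½), and the theorem is binomial inversion without its i = 0 term
-- (ln 2)ᵏ Li₁(½) = (ln 2)ᵏ⁺¹.  No integral is needed: the moments ∫ₓ¹ tⁿ (1 - t)ᵐ dt are
-- rational, so both sides of the formula are compared at partial sums of the same length,
-- up to an explicit error that tends to 0.

module Submission where

open import Defs
open import Data.List.Base using (replicate)
open import Data.Nat.Base as ℕ using (ℕ; zero; suc; pred; _∸_; _!; NonZero; z≤n; s≤s)
import Data.Nat.Properties as ℕ
open import Data.Nat.Combinatorics
  using (_C_; nCk≡n!/k![n-k]!; k![n∸k]!∣n!; k>n⇒nCk≡0; nCk+nC[k+1]≡[n+1]C[k+1])
open import Data.Nat.DivMod using (m/n*n≡m)
open import Data.Product using (_,_; proj₁; proj₂)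
open import Data.Rational.Base
  using (ℚ; 0ℚ; 1ℚ; ½; _+_; _*_; _-_; -_; _≤_; _<_; ∣_∣; +-*-rawSemiring)
open import Data.Rational.Properties
open import Data.Sum.Base using (inj₁; inj₂)
open import Data.Rational.Solver using (module +-*-Solver)
open import Relation.Nullary using (Dec; yes; no; ¬_)
open import Relation.Binary.PropositionalEquality
  using (_≡_; refl; sym; trans; cong; cong₂; subst)
open import Algebra.Definitions.RawSemiring +-*-rawSemiring using (_^_)

open RationalLemmas
open CauchyLemmas using (eventually-bounded)
open SeriesLemmas
open ReciprocalLemmas
open ≤-Reasoning
open +-*-Solver using (solve; _:=_; _:+_; _:*_; _:-_; :-_; con)

-- At a general point x the composition formula pairs ζ({1}_r; x) = (- ln(1 - x))ʳ / r! with
-- Li_{j+1}(1 - x). At x = ½, the fixed point of x ↦ 1 - x, the logarithm that is raised to powers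
-- and Li₁ coincide, so the term removed from the inversion is itself a power of ln 2. The obstacle
-- is that ln 2 is given as a limit of Riemann sums, while the formula yields powers of ∑ ½ᵏ/k, and
-- the two sequences agree only in the limit. The right-endpoint sum of 1/t on [1, 2] is 1/(n+1) + ⋯
-- + 1/(2n), a partial sum of the alternating harmonic series, and Euler's transformation carries
-- that series to ∑ ½ᵏ/k. Binomial inversion itself involves no limit: it is an identity in an
-- arbitrary rational c, applied at each index with c the Riemann sum there. Limits enter only where
-- one sequence is exchanged for another.

-- Finite sums

∑-cong⁺ : ∀ n {f g} → (∀ k → f (suc k) ≡ g (suc k)) → ∑₁ n f ≡ ∑₁ n g
∑-cong⁺ zero    h = refl
∑-cong⁺ (suc n) h = cong₂ _+_ (∑-cong⁺ n h) (h n)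

∑-mono⁺ : ∀ n {f g} → (∀ k → k ℕ.< n → f (suc k) ≤ g (suc k)) → ∑₁ n f ≤ ∑₁ n g
∑-mono⁺ zero    h = ≤-refl
∑-mono⁺ (suc n) h = +-mono-≤ (∑-mono⁺ n λ k k<n → h k (ℕ.m<n⇒m<1+n k<n)) (h n ℕ.≤-refl)

∑-distrib-+ : ∀ n f g → ∑₁ n (λ k → f k + g k) ≡ ∑₁ n f + ∑₁ n g
∑-distrib-+ zero    f g = refl
∑-distrib-+ (suc n) f g = trans (cong (_+ (f (suc n) + g (suc n))) (∑-distrib-+ n f g))
  (solve 4 (λ a b c d → a :+ b :+ (c :+ d) := a :+ c :+ (b :+ d)) refl (∑₁ n f) (∑₁ n g) (f (suc n)) (g (suc n)))

∑-distribˡ-* : ∀ n c f → ∑₁ n (λ k → c * f k) ≡ c * ∑₁ n f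
∑-distribˡ-* zero    c f = sym (*-zeroʳ c)
∑-distribˡ-* (suc n) c f = trans (cong (_+ c * f (suc n)) (∑-distribˡ-* n c f))
  (sym (*-distribˡ-+ c (∑₁ n f) (f (suc n))))

∑-head : ∀ n f → ∑₁ (suc n) f ≡ f 1 + ∑₁ n (λ k → f (suc k))
∑-head zero    f = +-comm 0ℚ (f 1)
∑-head (suc n) f = trans (cong (_+ f (suc (suc n))) (∑-head n f)) (+-assoc (f 1) _ _)

∑-reverse : ∀ n f → ∑₁ n (λ k → f (suc n ∸ k)) ≡ ∑₁ n f
∑-reverse zero    f = refl
∑-reverse (suc n) f = begin-equality
  ∑₁ (suc n) (λ k → f (suc (suc n) ∸ k))    ≡⟨ ∑-head n (λ k → f (suc (suc n) ∸ k)) ⟩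
  f (suc n) + ∑₁ n (λ k → f (suc n ∸ k))    ≡⟨ cong (f (suc n) +_) (∑-reverse n f) ⟩
  f (suc n) + ∑₁ n f                        ≡⟨ +-comm (f (suc n)) (∑₁ n f) ⟩
  ∑₁ (suc n) f                              ∎

∑-monoˡ : ∀ {m n} f → (∀ k → 0ℚ ≤ f (suc k)) → m ℕ.≤ n → ∑₁ m f ≤ ∑₁ n f
∑-monoˡ {n = zero}  f h z≤n = ≤-refl
∑-monoˡ {m} {suc n} f h m≤n with ℕ.m≤n⇒m<n∨m≡n m≤n
... | inj₁ (s≤s m≤n′) = ≤-trans (∑-monoˡ f h m≤n′) (≤-+ʳ (∑₁ n f) (h n))
... | inj₂ refl = ≤-refl

-- Unfolds at the head, unlike `∑₁`, so that shifting the index is definitional; `pairing-β` and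
-- `binomial-suc` rely on this.
∑₀ : ℕ → (ℕ → ℚ) → ℚ
∑₀ zero    f = f 0
∑₀ (suc n) f = f 0 + ∑₀ n (λ k → f (suc k))

∑₀-cong : ∀ n {f g} → (∀ k → k ℕ.≤ n → f k ≡ g k) → ∑₀ n f ≡ ∑₀ n g
∑₀-cong zero    h = h 0 z≤n
∑₀-cong (suc n) h = cong₂ _+_ (h 0 z≤n) (∑₀-cong n λ k k≤n → h (suc k) (s≤s k≤n))

∑₀-distrib-+ : ∀ n f g → ∑₀ n (λ k → f k + g k) ≡ ∑₀ n f + ∑₀ n g
∑₀-distrib-+ zero    f g = refl
∑₀-distrib-+ (suc n) f g = trans (cong (f 0 + g 0 +_) (∑₀-distrib-+ n (λ k → f (suc k)) (λ k → g (suc k))))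
  (solve 4 (λ a b c d → a :+ b :+ (c :+ d) := a :+ c :+ (b :+ d)) refl (f 0) (g 0) (∑₀ n _) (∑₀ n _))

∑₀-distribˡ-* : ∀ n c f → ∑₀ n (λ k → c * f k) ≡ c * ∑₀ n f
∑₀-distribˡ-* zero    c f = refl
∑₀-distribˡ-* (suc n) c f = trans (cong (c * f 0 +_) (∑₀-distribˡ-* n c (λ k → f (suc k))))
  (sym (*-distribˡ-+ c (f 0) _))

∑₀-last : ∀ n f → ∑₀ (suc n) f ≡ ∑₀ n f + f (suc n)
∑₀-last zero    f = refl
∑₀-last (suc n) f = trans (cong (f 0 +_) (∑₀-last n (λ k → f (suc k)))) (sym (+-assoc (f 0) _ _))

∑₀≡head+∑₁ : ∀ n f → ∑₀ n f ≡ f 0 + ∑₁ n f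
∑₀≡head+∑₁ zero    f = sym (+-identityʳ (f 0))
∑₀≡head+∑₁ (suc n) f = trans (∑₀-last n f)
  (trans (cong (_+ f (suc n)) (∑₀≡head+∑₁ n f)) (+-assoc (f 0) (∑₁ n f) (f (suc n))))

-- Reciprocals and the moments ∫ₓ¹ tⁿ (1 - t)ᵐ dt

recip-cancel : ∀ n {p q} → ι (suc n) * p ≡ q → p ≡ recip (suc n) * q
recip-cancel n {p} {q} e = begin-equality
  p                                  ≡⟨ sym (*-identityˡ p) ⟩
  1ℚ * p                             ≡⟨ cong (_* p) (sym (recip-inv n)) ⟩
  recip (suc n) * ι (suc n) * p      ≡⟨ *-assoc (recip (suc n)) (ι (suc n)) p ⟩
  recip (suc n) * (ι (suc n) * p)    ≡⟨ cong (recip (suc n) *_) e ⟩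
  recip (suc n) * q                  ∎

recip-inv-* : ∀ n q → ι (suc n) * (recip (suc n) * q) ≡ q
recip-inv-* n q = begin-equality
  ι (suc n) * (recip (suc n) * q)    ≡⟨ solve 3 (λ i r q → i :* (r :* q) := r :* i :* q) refl (ι (suc n)) (recip (suc n)) q ⟩
  recip (suc n) * ι (suc n) * q      ≡⟨ cong (_* q) (recip-inv n) ⟩
  1ℚ * q                             ≡⟨ *-identityˡ q ⟩
  q                                  ∎

recip-unique : ∀ n {q} → ι (suc n) * q ≡ 1ℚ → q ≡ recip (suc n)
recip-unique n e = trans (recip-cancel n e) (*-identityʳ (recip (suc n)))

-- β x n m = ∫ₓ¹ tⁿ (1 - t)ᵐ dt, presented as a difference table

β : ℚ → ℕ → ℕ → ℚ
β x zero    m = (1ℚ - x) ^ suc m * recip (suc m)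
β x (suc n) m = β x n m - β x n (suc m)

-- integration by parts; at n = 0 the junk value pred 0 = 0 is multiplied by 0
β-parts : ∀ x n m → ι (suc (n ℕ.+ m)) * β x n m ≡ x ^ n * (1ℚ - x) ^ suc m + ι n * β x (pred n) m
β-parts x zero    m = begin-equality
  i * ((1ℚ - x) ^ suc m * recip (suc m))   ≡⟨ cong (i *_) (*-comm _ (recip (suc m))) ⟩
  i * (recip (suc m) * (1ℚ - x) ^ suc m)   ≡⟨ recip-inv-* m ((1ℚ - x) ^ suc m) ⟩
  (1ℚ - x) ^ suc m
    ≡⟨ solve 2 (λ a b → a := con 1ℚ :* a :+ con 0ℚ :* b) refl ((1ℚ - x) ^ suc m) (β x 0 m) ⟩
  1ℚ * (1ℚ - x) ^ suc m + ι 0 * β x 0 m    ∎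
  where i = ι (suc m)
β-parts x (suc n) m = begin-equality
  ι (suc (suc (n ℕ.+ m))) * (b - b₁)
    ≡⟨ cong (_* (b - b₁)) (ι-suc (suc (n ℕ.+ m))) ⟩
  (i + 1ℚ) * (b - b₁)
    ≡⟨ solve 3 (λ i b b₁ → (i :+ con 1ℚ) :* (b :- b₁) := i :* b :+ b :- (i :+ con 1ℚ) :* b₁) refl i b b₁ ⟩
  i * b + b - (i + 1ℚ) * b₁
    ≡⟨ cong₂ (λ s t → s + b - t) (β-parts x n m) parts₁ ⟩
  x ^ n * y + ι n * c + b - (x ^ n * ((1ℚ - x) * y) + ι n * c₁)
    ≡⟨ solve 7 (λ x p y i c b c₁ → p :* y :+ i :* c :+ b :- (p :* ((con 1ℚ :- x) :* y) :+ i :* c₁)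
                  := x :* p :* y :+ (b :+ i :* (c :- c₁))) refl x (x ^ n) y (ι n) c b c₁ ⟩
  x * x ^ n * y + (b + ι n * (c - c₁))
    ≡⟨ cong (λ t → x * x ^ n * y + (b + t)) (shift n) ⟩
  x * x ^ n * y + (b + ι n * b)
    ≡⟨ cong (x * x ^ n * y +_) (solve 2 (λ b i → b :+ i :* b := (i :+ con 1ℚ) :* b) refl b (ι n)) ⟩
  x * x ^ n * y + (ι n + 1ℚ) * b
    ≡⟨ cong (λ t → x * x ^ n * y + t * b) (sym (ι-suc n)) ⟩
  x * x ^ n * y + ι (suc n) * b     ∎
  where
  i b b₁ c c₁ y : ℚ
  i = ι (suc (n ℕ.+ m)) ; b = β x n m ; b₁ = β x n (suc m)
  c = β x (pred n) m ; c₁ = β x (pred n) (suc m)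
  y = (1ℚ - x) ^ suc m
  parts₁ : (i + 1ℚ) * b₁ ≡ x ^ n * ((1ℚ - x) * y) + ι n * c₁
  parts₁ = trans (cong (_* b₁) (trans (sym (ι-suc (suc (n ℕ.+ m)))) (cong (λ k → ι (suc k)) (sym (ℕ.+-suc n m)))))
    (β-parts x n (suc m))
  shift : ∀ n → ι n * (β x (pred n) m - β x (pred n) (suc m)) ≡ ι n * β x n m
  shift zero    = trans (*-zeroˡ (β x 0 m - β x 0 (suc m))) (sym (*-zeroˡ (β x 0 m)))
  shift (suc n) = refl

-- Integration by parts with (1 - t)ᵐ as the integrated factor. The remaining moment of tⁿ⁻¹ (1 -
-- t)ᵐ⁺¹ is written as a difference in n, the shape that `abel` sums.
β-parts-Δ : ∀ x n m → ι (suc m) * β x n m ≡ x ^ n * (1ℚ - x) ^ suc m + ι n * (β x (pred n) m - β x n m)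
β-parts-Δ x n m = begin-equality
  ι (suc m) * b
    ≡⟨ solve 3 (λ i j b → i :* b := (j :+ i) :* b :- j :* b) refl (ι (suc m)) (ι n) b ⟩
  (ι n + ι (suc m)) * b - ι n * b
    ≡⟨ cong (λ t → t * b - ι n * b) (trans (sym (ι-+ n (suc m))) (cong ι (ℕ.+-suc n m))) ⟩
  ι (suc (n ℕ.+ m)) * b - ι n * b
    ≡⟨ cong (_- ι n * b) (β-parts x n m) ⟩
  p + ι n * c - ι n * b
    ≡⟨ solve 4 (λ p j b c → p :+ j :* c :- j :* b := p :+ j :* (c :- b)) refl p (ι n) b c ⟩
  p + ι n * (c - b) ∎
  where
  b c p : ℚ
  b = β x n m ; c = β x (pred n) m ; p = x ^ n * (1ℚ - x) ^ suc m

-- The table grows from its row n = 0, so the column ∫ₓ¹ tⁿ dt has to be recovered by induction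
-- through `β-parts`.
β-column₀ : ∀ x n → ι (suc n) * β x n 0 ≡ 1ℚ - x ^ suc n
β-column₀ x n = begin-equality
  ι (suc n) * β x n 0
    ≡⟨ cong (λ k → ι (suc k) * β x n 0) (sym (ℕ.+-identityʳ n)) ⟩
  ι (suc (n ℕ.+ 0)) * β x n 0                            ≡⟨ β-parts x n 0 ⟩
  x ^ n * ((1ℚ - x) * 1ℚ) + ι n * β x (pred n) 0         ≡⟨ cong (x ^ n * ((1ℚ - x) * 1ℚ) +_) (prev n) ⟩
  x ^ n * ((1ℚ - x) * 1ℚ) + (1ℚ - x ^ n)
    ≡⟨ solve 2 (λ x p → p :* ((con 1ℚ :- x) :* con 1ℚ) :+ (con 1ℚ :- p) := con 1ℚ :- x :* p) refl x (x ^ n) ⟩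
  1ℚ - x ^ suc n                                         ∎
  where
  prev : ∀ n → ι n * β x (pred n) 0 ≡ 1ℚ - x ^ n
  prev zero    = *-zeroˡ (β x 0 0)
  prev (suc n) = β-column₀ x n

module _ {x : ℚ} (0≤x : 0ℚ ≤ x) (x≤1 : x ≤ 1ℚ) where

  private
    0≤1-x : 0ℚ ≤ 1ℚ - x
    0≤1-x = p≤q⇒0≤q-p x≤1

  -- The subtractions that define `β` hide its sign; `β-parts` rewrites each entry as a sum of
  -- nonnegative terms.
  β-nonneg : ∀ n m → 0ℚ ≤ β x n m
  β-nonneg n m = subst (0ℚ ≤_) (sym (recip-cancel (n ℕ.+ m) (β-parts x n m)))
    (*-nonneg (recip-nonneg (suc (n ℕ.+ m)))
      (+-nonneg (*-nonneg (^-nonneg n 0≤x) (^-nonneg (suc m) 0≤1-x)) (prev n)))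
    where
    prev : ∀ n → 0ℚ ≤ ι n * β x (pred n) m
    prev zero    = ≤-reflexive (sym (*-zeroˡ (β x 0 m)))
    prev (suc n) = *-nonneg (ι-nonneg (suc n)) (β-nonneg n m)

  β-row-anti : ∀ n m → β x n m ≤ β x 0 m
  β-row-anti zero    m = ≤-refl
  β-row-anti (suc n) m = ≤-trans (p-q≤p (β x n m) (β-nonneg n (suc m))) (β-row-anti n m)

  β-column-anti : ∀ n m → β x n m ≤ β x n 0
  β-column-anti n zero    = ≤-refl
  β-column-anti n (suc m) = ≤-trans
    (0≤q-p⇒p≤q (β-nonneg (suc n) m)) (β-column-anti n m)

  β≤recip : ∀ n m → β x n m ≤ recip (suc n)
  β≤recip n m = begin
    β x n m                           ≤⟨ β-column-anti n m ⟩
    β x n 0                           ≡⟨ recip-cancel n (β-column₀ x n) ⟩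
    recip (suc n) * (1ℚ - x ^ suc n)
      ≤⟨ *-mono-l (recip (suc n)) (recip-nonneg (suc n)) (p-q≤p 1ℚ (^-nonneg (suc n) 0≤x)) ⟩
    recip (suc n) * 1ℚ                ≡⟨ *-identityʳ (recip (suc n)) ⟩
    recip (suc n)                     ∎

-- Elementary bounds

∑-bounded : ∀ n {f c} → (∀ k → k ℕ.< n → f (suc k) ≤ c) → ∑₁ n f ≤ ι n * c
∑-bounded zero    {c = c} h = ≤-reflexive (sym (*-zeroˡ c))
∑-bounded (suc n) {f} {c} h = begin
  ∑₁ n f + f (suc n)    ≤⟨ +-mono-≤ (∑-bounded n λ k k<n → h k (ℕ.m<n⇒m<1+n k<n)) (h n ℕ.≤-refl) ⟩
  ι n * c + c           ≡⟨ solve 2 (λ i c → i :* c :+ c := (i :+ con 1ℚ) :* c) refl (ι n) c ⟩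
  (ι n + 1ℚ) * c        ≡⟨ cong (_* c) (sym (ι-suc n)) ⟩
  ι (suc n) * c         ∎

recip-anti-+ : ∀ d n → recip (suc (d ℕ.+ n)) ≤ recip (suc n)
recip-anti-+ zero    n = ≤-refl
recip-anti-+ (suc d) n = ≤-trans (recip-anti (d ℕ.+ n)) (recip-anti-+ d n)

ι*recip≤1 : ∀ {m n} → m ℕ.≤ suc n → ι m * recip (suc n) ≤ 1ℚ
ι*recip≤1 {m} {n} m≤n = subst (ι m * recip (suc n) ≤_)
  (trans (*-comm (ι (suc n)) (recip (suc n))) (recip-inv n))
  (*-mono-r (recip (suc n)) (recip-nonneg (suc n)) (ι-mono m≤n))

∣p-q∣≤p+q : ∀ {p q} → 0ℚ ≤ p → 0ℚ ≤ q → ∣ p - q ∣ ≤ p + q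
∣p-q∣≤p+q {p} {q} 0≤p 0≤q = ∣ p - q ∣≤
  (≤-trans (p-q≤p p 0≤q) (≤-+ʳ p 0≤q))
  (subst (_≤ p + q) (solve 2 (λ p q → q :- p := :- (p :- q)) refl p q)
    (≤-trans (p-q≤p q 0≤p) (≤-+ˡ q 0≤p)))

-- Null sequences and asymptotic equality

Tends0-+ : ∀ {F G} → Tends0 F → Tends0 G → Tends0 (λ n → F n + G n)
Tends0-+ {F} {G} F→0 G→0 ε 0<ε with F→0 (½ * ε) (half-pos 0<ε) | G→0 (½ * ε) (half-pos 0<ε)
... | M , hM | N , hN = M ℕ.⊔ N , λ n p → subst (F n + G n ≤_) (half+half ε)
  (+-mono-≤ (hM n (ℕ.m⊔n≤o⇒m≤o M N p)) (hN n (ℕ.m⊔n≤o⇒n≤o M N p)))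

Tends0-* : ∀ {c F} → 0ℚ ≤ c → Tends0 F → Tends0 (λ n → c * F n)
Tends0-* {c} {F} 0≤c F→0 ε 0<ε = proj₁ small , λ n p → begin
  c * F n                          ≤⟨ *-mono-l c 0≤c (proj₂ small n p) ⟩
  c * δ                            ≤⟨ *-mono-r δ (<⇒≤ 0<δ) c≤K ⟩
  ι (suc K) * (recip (suc K) * ε)  ≡⟨ recip-inv-* K ε ⟩
  ε                                ∎
  where
  arch = archimedean c 0<1
  K = proj₁ arch
  c≤K : c ≤ ι (suc K)
  c≤K = ≤-trans (proj₂ arch) (subst (_≤ ι (suc K)) (sym (*-identityʳ (ι K))) (ι-mono (ℕ.n≤1+n K)))
  δ : ℚ
  δ = recip (suc K) * ε
  0<δ : 0ℚ < δ
  0<δ = *-pos (recip-pos K) 0<ε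
  small = F→0 δ 0<δ

Tends0-≤ : ∀ {F G} M → (∀ n → M ℕ.≤ n → F n ≤ G n) → Tends0 G → Tends0 F
Tends0-≤ M F≤G G→0 ε 0<ε with G→0 ε 0<ε
... | N , h = M ℕ.⊔ N , λ n p → ≤-trans (F≤G n (ℕ.m⊔n≤o⇒m≤o M N p)) (h n (ℕ.m⊔n≤o⇒n≤o M N p))

recip→0 : Tends0 recip
recip→0 = Tends0-≤ 0 (λ n _ → ≤-reflexive (sym (*-identityˡ (recip n)))) (H-quot 0)

½^→0 : Tends0 (½ ^_)
½^→0 = Geometric.q^→0 ½ ½ (ι 2) (<⇒≤ 0<½) 0<½ refl (ι-nonneg 2) refl
  where
  0<½ : 0ℚ < ½
  0<½ = recip-pos 1

infix 4 _≈_
-- A record, so that both sequences can be inferred from the type. It relates bare sequences because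
-- intermediate expressions come without a Cauchy proof.
record _≈_ (a b : ℕ → ℚ) : Set where
  constructor tends
  field distance→0 : Tends0 (λ n → ∣ a n - b n ∣)

≈⇒≃ : ∀ x y → seq x ≈ seq y → x ≃ y
≈⇒≃ _ _ = _≈_.distance→0

-- Index 0 is exempt, since `riemann-inv` is stated only for a positive number of pieces.
≡⇒≈ : ∀ {a b} → (∀ n → a (suc n) ≡ b (suc n)) → a ≈ b
≡⇒≈ {a} {b} h = tends λ ε 0<ε → 1 , λ { (suc n) _ → ≤-trans
  (≤-reflexive (cong ∣_∣ (trans (cong (_- b (suc n)) (h n)) (+-inverseʳ (b (suc n)))))) (<⇒≤ 0<ε) }

≈-refl : ∀ {a} → a ≈ a
≈-refl = ≡⇒≈ (λ _ → refl)

≈-sym : ∀ {a b} → a ≈ b → b ≈ a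
≈-sym {a} {b} (tends h) = tends (Tends0-≤ 0 (λ n _ → ≤-reflexive (∣p-q∣≡∣q-p∣ (b n) (a n))) h)

≈-trans : ∀ {a b c} → a ≈ b → b ≈ c → a ≈ c
≈-trans {a} {b} {c} (tends h) (tends k) = tends (Tends0-≤ 0 (λ n _ → begin
  ∣ a n - c n ∣
    ≡⟨ cong ∣_∣ (solve 3 (λ a b c → a :- c := (a :- b) :+ (b :- c)) refl (a n) (b n) (c n)) ⟩
  ∣ (a n - b n) + (b n - c n) ∣      ≤⟨ ∣p+q∣≤∣p∣+∣q∣ (a n - b n) (b n - c n) ⟩
  ∣ a n - b n ∣ + ∣ b n - c n ∣      ∎) (Tends0-+ h k))

≈-+ : ∀ {a a′ b b′} → a ≈ a′ → b ≈ b′ → (λ n → a n + b n) ≈ (λ n → a′ n + b′ n)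
≈-+ {a} {a′} {b} {b′} (tends h) (tends k) = tends (Tends0-≤ 0 (λ n _ → begin
  ∣ (a n + b n) - (a′ n + b′ n) ∣
    ≡⟨ cong ∣_∣ (solve 4 (λ a b c d → (a :+ b) :- (c :+ d) := (a :- c) :+ (b :- d)) refl (a n) (b n) (a′ n) (b′ n)) ⟩
  ∣ (a n - a′ n) + (b n - b′ n) ∣      ≤⟨ ∣p+q∣≤∣p∣+∣q∣ (a n - a′ n) (b n - b′ n) ⟩
  ∣ a n - a′ n ∣ + ∣ b n - b′ n ∣      ∎) (Tends0-+ h k))

-- The common factor is a real rather than a sequence, so that its Cauchy property supplies an
-- eventual bound.
≈-*ˡ : ∀ x {b b′} → b ≈ b′ → (λ n → seq x n * b n) ≈ (λ n → seq x n * b′ n)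
≈-*ˡ x {b} {b′} (tends h) = tends (Tends0-≤ (proj₁ (proj₂ (proj₂ bnd))) (λ n p → begin
  ∣ a n * b n - a n * b′ n ∣
    ≡⟨ cong ∣_∣ (solve 3 (λ a b c → a :* b :- a :* c := a :* (b :- c)) refl (a n) (b n) (b′ n)) ⟩
  ∣ a n * (b n - b′ n) ∣        ≡⟨ ∣p*q∣≡∣p∣*∣q∣ (a n) (b n - b′ n) ⟩
  ∣ a n ∣ * ∣ b n - b′ n ∣      ≤⟨ *-mono-r _ (0≤∣p∣ (b n - b′ n)) (proj₂ (proj₂ (proj₂ bnd)) n p) ⟩
  A * ∣ b n - b′ n ∣            ∎) (Tends0-* (<⇒≤ (proj₁ (proj₂ bnd))) h))
  where
  a = seq x
  bnd = eventually-bounded {a} (cauchy x)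
  A = proj₁ bnd

≈-*ʳ : ∀ x {b b′} → b ≈ b′ → (λ n → b n * seq x n) ≈ (λ n → b′ n * seq x n)
≈-*ʳ x {b} {b′} h = ≈-trans (≡⇒≈ λ n → *-comm (b (suc n)) (seq x (suc n)))
  (≈-trans (≈-*ˡ x h) (≡⇒≈ λ n → *-comm (seq x (suc n)) (b′ (suc n))))

-- ln 2 = ∑ ½ᵏ/k, by Euler's transformation of the alternating harmonic series.
-- β 0ℚ is the difference table of 1, 1/2, 1/3, …

β₀-row : ∀ n → β 0ℚ 0 n ≡ recip (suc n)
β₀-row n = trans (cong (_* recip (suc n)) (1^n (suc n))) (*-identityˡ (recip (suc n)))

β₀-column : ∀ n → β 0ℚ n 0 ≡ recip (suc n)
β₀-column n = recip-unique n (trans (β-column₀ 0ℚ n)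
  (cong (λ t → 1ℚ - t) (*-zeroˡ (0ℚ ^ n))))

-- The first K terms of the Euler transform of 1/(n + 1) - 1/(n + 2) + 1/(n + 3) - ⋯

euler : ℕ → ℕ → ℚ
euler K n = ∑₁ K λ k → ½ ^ k * β 0ℚ (pred k) n

-- The tails T n = 1/(n+1) - 1/(n+2) + ⋯ satisfy T n + T (n+1) = 1/(n+1); the first K terms of their
-- transform do so up to a K-th difference divided by 2ᴷ.
euler-pair : ∀ K n → euler K n + euler K (suc n) ≡ recip (suc n) - ½ ^ K * β 0ℚ K n
euler-pair zero    n = begin-equality
  0ℚ                                  ≡⟨ sym (+-inverseʳ (recip (suc n))) ⟩
  recip (suc n) - recip (suc n)
    ≡⟨ cong (λ t → recip (suc n) - t) (trans (sym (β₀-row n)) (sym (*-identityˡ (β 0ℚ 0 n)))) ⟩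
  recip (suc n) - 1ℚ * β 0ℚ 0 n       ∎
euler-pair (suc K) n = begin-equality
  e + ½ * p * b + (e₁ + ½ * p * b₁)
    ≡⟨ solve 5 (λ e p b e₁ b₁ → e :+ con ½ :* p :* b :+ (e₁ :+ con ½ :* p :* b₁)
         := (e :+ e₁) :+ con ½ :* p :* (b :+ b₁)) refl e p b e₁ b₁ ⟩
  (e + e₁) + ½ * p * (b + b₁)
    ≡⟨ cong (_+ ½ * p * (b + b₁)) (euler-pair K n) ⟩
  r - p * b + ½ * p * (b + b₁)
    ≡⟨ solve 4 (λ r p b b₁ → r :- p :* b :+ con ½ :* p :* (b :+ b₁) := r :- con ½ :* p :* (b :- b₁))
         refl r p b b₁ ⟩
  r - ½ * p * (b - b₁) ∎
  where
  e e₁ p b b₁ r : ℚ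
  e = euler K n ; e₁ = euler K (suc n) ; p = ½ ^ K
  b = β 0ℚ K n ; b₁ = β 0ℚ K (suc n) ; r = recip (suc n)

-- The bridge between the integral and the series: a Riemann sum of 1/t by `riemann-inv`, and an
-- alternating harmonic sum by `halfHarmonic-suc`.
halfHarmonic : ℕ → ℚ
halfHarmonic n = ∑₁ n λ j → recip (n ℕ.+ j)

recip-double : ∀ n → recip (suc (suc (n ℕ.+ n))) + recip (suc (suc (n ℕ.+ n))) ≡ recip (suc n)
recip-double n = recip-unique n (begin-equality
  ι (suc n) * (r + r)
    ≡⟨ solve 2 (λ i r → i :* (r :+ r) := r :* (i :+ i)) refl (ι (suc n)) r ⟩
  r * (ι (suc n) + ι (suc n))
    ≡⟨ cong (r *_) (trans (sym (ι-+ (suc n) (suc n))) (cong (λ k → ι (suc k)) (ℕ.+-suc n n))) ⟩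
  r * ι (suc (suc (n ℕ.+ n)))      ≡⟨ recip-inv (suc (n ℕ.+ n)) ⟩
  1ℚ                               ∎)
  where
  r : ℚ
  r = recip (suc (suc (n ℕ.+ n)))

-- Catalan's identity as an increment: 1/(n+1) leaves, 1/(2n+1) and 1/(2n+2) enter, and 1/(n+1) =
-- 2/(2n+2).
halfHarmonic-suc : ∀ n →
  halfHarmonic (suc n) ≡ halfHarmonic n + (recip (suc (n ℕ.+ n)) - recip (suc (suc (n ℕ.+ n))))
halfHarmonic-suc n = begin-equality
  halfHarmonic (suc n)
    ≡⟨ ∑-cong (suc n) (λ j → cong recip (sym (ℕ.+-suc n j))) ⟩
  ∑₁ (suc n) (λ j → g (suc j))
    ≡⟨ solve 2 (λ a s → s := (a :+ s) :- a) refl (g 1) _ ⟩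
  g 1 + ∑₁ (suc n) (λ j → g (suc j)) - g 1
    ≡⟨ cong (_- g 1) (sym (∑-head (suc n) g)) ⟩
  halfHarmonic n + g (suc n) + g (suc (suc n)) - g 1
    ≡⟨ cong₂ (λ s t → halfHarmonic n + s + t - g 1) (cong recip (ℕ.+-suc n n))
         (cong recip (trans (ℕ.+-suc n (suc n)) (cong suc (ℕ.+-suc n n)))) ⟩
  halfHarmonic n + u + v - g 1
    ≡⟨ cong (λ t → halfHarmonic n + u + v - t) (trans (cong recip (ℕ.+-comm n 1)) (sym (recip-double n))) ⟩
  halfHarmonic n + u + v - (v + v)
    ≡⟨ solve 3 (λ s u v → s :+ u :+ v :- (v :+ v) := s :+ (u :- v)) refl (halfHarmonic n) u v ⟩
  halfHarmonic n + (u - v) ∎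
  where
  g : ℕ → ℚ
  g j = recip (n ℕ.+ j)
  u v : ℚ
  u = recip (suc (n ℕ.+ n)) ; v = recip (suc (suc (n ℕ.+ n)))

eulerError : ℕ → ℕ → ℚ
eulerError K N = ∑₁ N λ j → β 0ℚ (suc K) (pred j ℕ.+ pred j)

-- The alternating sum of `euler-pair` over the first 2N indices telescopes. The errors at 2j and 2j
-- + 1 have opposite signs and combine to a (K+1)-st difference, hence `eulerError`.
euler-expand : ∀ K N → euler K 0 + ½ ^ K * eulerError K N ≡ halfHarmonic N + euler K (N ℕ.+ N)
euler-expand K zero    = solve 2 (λ e p → e :+ p :* con 0ℚ := con 0ℚ :+ e) refl (euler K 0) (½ ^ K)
euler-expand K (suc N) = begin-equality
  euler K 0 + p * (R + (b - b₁))
    ≡⟨ solve 5 (λ e p R b b₁ → e :+ p :* (R :+ (b :- b₁)) := (e :+ p :* R) :+ p :* (b :- b₁))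
         refl (euler K 0) p R b b₁ ⟩
  (euler K 0 + p * R) + p * (b - b₁)
    ≡⟨ cong (_+ p * (b - b₁)) (euler-expand K N) ⟩
  s + e₀ + p * (b - b₁)
    ≡⟨ solve 7 (λ s e₀ e₁ e₂ p b b₁ → s :+ e₀ :+ p :* (b :- b₁) :=
          s :+ e₂ :+ ((e₀ :+ e₁) :+ p :* b :- ((e₁ :+ e₂) :+ p :* b₁))) refl s e₀ e₁ e₂ p b b₁ ⟩
  s + e₂ + ((e₀ + e₁) + p * b - ((e₁ + e₂) + p * b₁))
    ≡⟨ cong₂ (λ x y → s + e₂ + (x + p * b - (y + p * b₁))) (euler-pair K (N ℕ.+ N)) (euler-pair K (suc (N ℕ.+ N))) ⟩
  s + e₂ + ((u - p * b) + p * b - ((v - p * b₁) + p * b₁))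
    ≡⟨ solve 7 (λ s e₂ u v p b b₁ → s :+ e₂ :+ ((u :- p :* b) :+ p :* b :- ((v :- p :* b₁) :+ p :* b₁))
          := s :+ (u :- v) :+ e₂) refl s e₂ u v p b b₁ ⟩
  s + (u - v) + e₂
    ≡⟨ cong₂ _+_ (sym (halfHarmonic-suc N)) (cong (λ k → euler K (suc k)) (sym (ℕ.+-suc N N))) ⟩
  halfHarmonic (suc N) + euler K (suc N ℕ.+ suc N) ∎
  where
  p R b b₁ s e₀ e₁ e₂ u v : ℚ
  p = ½ ^ K ; R = eulerError K N
  b = β 0ℚ K (N ℕ.+ N) ; b₁ = β 0ℚ K (suc (N ℕ.+ N))
  s = halfHarmonic N
  e₀ = euler K (N ℕ.+ N) ; e₁ = euler K (suc (N ℕ.+ N)) ; e₂ = euler K (suc (suc (N ℕ.+ N)))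
  u = recip (suc (N ℕ.+ N)) ; v = recip (suc (suc (N ℕ.+ N)))

0≤½ : 0ℚ ≤ ½
0≤½ = recip-nonneg 2

euler-nonneg : ∀ K n → 0ℚ ≤ euler K n
euler-nonneg K n = ∑-nonneg K λ k → *-nonneg (^-nonneg k 0≤½) (β-nonneg ≤-refl 0≤1 (pred k) n)

euler≤recip : ∀ K n → euler K n ≤ recip (suc n)
euler≤recip K n = begin
  euler K n                          ≤⟨ ≤-+ʳ (euler K n) (euler-nonneg K (suc n)) ⟩
  euler K n + euler K (suc n)        ≡⟨ euler-pair K n ⟩
  recip (suc n) - ½ ^ K * β 0ℚ K n
    ≤⟨ p-q≤p (recip (suc n)) (*-nonneg (^-nonneg K 0≤½) (β-nonneg ≤-refl 0≤1 K n)) ⟩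
  recip (suc n)                      ∎

-- `euler-expand` on the diagonal K = N: the N error entries are at most 1/(N+2) each and carry the
-- factor ½ᴺ, and the leftover tail is at most 1/(2N+1).
halfHarmonic≈euler : halfHarmonic ≈ (λ N → euler N 0)
halfHarmonic≈euler = tends (Tends0-≤ 1 bound (Tends0-+ ½^→0 recip→0))
  where
  bound : ∀ N → 1 ℕ.≤ N → ∣ halfHarmonic N - euler N 0 ∣ ≤ ½ ^ N + recip N
  bound N@(suc n) _ = begin
    ∣ halfHarmonic N - euler N 0 ∣
      ≡⟨ cong ∣_∣ (solve 4 (λ s e f g → s :- e := (s :+ f) :- (e :+ g) :+ (g :- f)) refl
           (halfHarmonic N) (euler N 0) e err) ⟩
    ∣ (halfHarmonic N + e) - (euler N 0 + err) + (err - e) ∣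
      ≡⟨ cong (λ t → ∣ (halfHarmonic N + e) - t + (err - e) ∣) (euler-expand N N) ⟩
    ∣ (halfHarmonic N + e) - (halfHarmonic N + e) + (err - e) ∣
      ≡⟨ cong ∣_∣ (solve 2 (λ s d → s :- s :+ d := d) refl (halfHarmonic N + e) (err - e)) ⟩
    ∣ err - e ∣       ≤⟨ ∣p-q∣≤p+q (*-nonneg (^-nonneg N 0≤½) 0≤R) (euler-nonneg N (N ℕ.+ N)) ⟩
    err + e           ≤⟨ +-mono-≤ err≤ (≤-trans (euler≤recip N (N ℕ.+ N)) recip≤) ⟩
    ½ ^ N + recip N   ∎
    where
    e err : ℚ
    e = euler N (N ℕ.+ N) ; err = ½ ^ N * eulerError N N
    0≤R : 0ℚ ≤ eulerError N N
    0≤R = ∑-nonneg N λ j → β-nonneg ≤-refl 0≤1 (suc N) (pred j ℕ.+ pred j)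
    err≤ : err ≤ ½ ^ N
    err≤ = begin
      ½ ^ N * eulerError N N
        ≤⟨ *-mono-l (½ ^ N) (^-nonneg N 0≤½) (∑-bounded N λ k _ → β≤recip ≤-refl 0≤1 (suc N) (k ℕ.+ k)) ⟩
      ½ ^ N * (ι N * recip (suc (suc N)))
        ≤⟨ *-mono-l (½ ^ N) (^-nonneg N 0≤½) (ι*recip≤1 (ℕ.≤-trans (ℕ.n≤1+n N) (ℕ.n≤1+n (suc N)))) ⟩
      ½ ^ N * 1ℚ      ≡⟨ *-identityʳ (½ ^ N) ⟩
      ½ ^ N           ∎
    recip≤ : recip (suc (N ℕ.+ N)) ≤ recip N
    recip≤ = subst (λ k → recip (suc k) ≤ recip N) (sym (ℕ.+-suc N n)) (recip-anti-+ (suc N) n)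

-- The sample points are (n+1+j)/(n+1) and the width is 1/(n+1), so each summand is exactly
-- 1/(n+1+j).
riemann-inv : ∀ n → riemann inv 1ℚ (ι 2) (suc n) ≡ halfHarmonic (suc n)
riemann-inv n = ∑-cong (suc n) λ j → recip-unique (n ℕ.+ j) (begin-equality
  ι (suc (n ℕ.+ j)) * (h * inv (q j))      ≡⟨ cong (_* (h * inv (q j))) (ι-q j) ⟩
  ι (suc n) * q j * (h * inv (q j))
    ≡⟨ solve 4 (λ i q h v → i :* q :* (h :* v) := i :* h :* (v :* q)) refl (ι (suc n)) (q j) h (inv (q j)) ⟩
  ι (suc n) * h * (inv (q j) * q j)        ≡⟨ cong₂ _*_ ι*h (inv-* (0<q j)) ⟩
  1ℚ                                       ∎)
  where
  h : ℚ
  h = (ι 2 - 1ℚ) * recip (suc n)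
  q : ℕ → ℚ
  q j = 1ℚ + ι j * h
  ι*h : ι (suc n) * h ≡ 1ℚ
  ι*h = trans (cong (ι (suc n) *_) (*-comm 1ℚ (recip (suc n)))) (recip-inv-* n 1ℚ)
  0<q : ∀ j → 0ℚ < q j
  0<q j = +-pos 0<1 (*-nonneg (ι-nonneg j) (*-nonneg 0≤1 (recip-nonneg (suc n))))
  ι-q : ∀ j → ι (suc (n ℕ.+ j)) ≡ ι (suc n) * q j
  ι-q j = begin-equality
    ι (suc n ℕ.+ j)                    ≡⟨ ι-+ (suc n) j ⟩
    ι (suc n) + ι j                    ≡⟨ solve 2 (λ a b → a :+ b := a :+ b :* con 1ℚ) refl (ι (suc n)) (ι j) ⟩
    ι (suc n) + ι j * 1ℚ               ≡⟨ cong (λ t → ι (suc n) + ι j * t) (sym ι*h) ⟩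
    ι (suc n) + ι j * (ι (suc n) * h)
      ≡⟨ solve 3 (λ a b h → a :+ b :* (a :* h) := a :* (con 1ℚ :+ b :* h)) refl (ι (suc n)) (ι j) h ⟩
    ι (suc n) * q j                    ∎

ln2≈Li₁ : seq (ln (ι 2)) ≈ seq (Li 1 ½)
ln2≈Li₁ = ≈-trans (≡⇒≈ riemann-inv) (≈-trans halfHarmonic≈euler (≡⇒≈ λ n →
  ∑-cong⁺ (suc n) λ k → cong (½ ^ suc k *_)
    (trans (β₀-column k) (sym (*-identityʳ (recip (suc k)))))))

-- Multiple harmonic weights and the path composition formula

∑-∑₀-swap : ∀ M r f → ∑₁ M (λ m → ∑₀ r (λ j → f j m)) ≡ ∑₀ r (λ j → ∑₁ M (f j))
∑-∑₀-swap M zero    f = refl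
∑-∑₀-swap M (suc r) f = trans (∑-distrib-+ M (f 0) (λ m → ∑₀ r (λ j → f (suc j) m)))
  (cong (∑₁ M (f 0) +_) (∑-∑₀-swap M r (λ j → f (suc j))))

-- The coefficient of xⁿ in ζ({1}_{r+1}; x)

h : ℕ → ℕ → ℚ
h r n = recip n ^ 1 * H r (pred n)

h-nonneg : ∀ r n → 0ℚ ≤ h r n
h-nonneg r n = *-nonneg (^-nonneg 1 (recip-nonneg n)) (truncated-nonneg (replicate r 1) (pred n))

ι*h : ∀ r n → ι (suc n) * h r (suc n) ≡ H r n
ι*h r n = trans (cong (λ t → ι (suc n) * (t * H r n)) (*-identityʳ (recip (suc n)))) (recip-inv-* n (H r n))

h≤1 : ∀ r n → h r (suc n) ≤ 1ℚ
h≤1 r n = begin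
  recip (suc n) * 1ℚ * H r n    ≡⟨ cong (_* H r n) (*-identityʳ (recip (suc n))) ⟩
  recip (suc n) * H r n         ≤⟨ *-mono-l (recip (suc n)) (recip-nonneg (suc n)) (H≤ r n) ⟩
  recip (suc n) * ι (suc n)     ≡⟨ recip-inv n ⟩
  1ℚ                            ∎

-- pairing r N φ = ∑_{n ≤ N} φ n · [xⁿ] ζ({1}_r; x), where ζ({1}_0; x) = 1

pairing : ℕ → ℕ → (ℕ → ℚ) → ℚ
pairing zero    N φ = φ 0
pairing (suc r) N φ = ∑₁ N λ n → φ n * h r n

-- Summation by parts: `h r` is the increment of `H (suc r)`. For r = 0 the weight is constantly 1
-- and the sum telescopes to φ 0, matching ζ({1}_0; x) = 1.
abel : ∀ r N φ → ∑₁ N (λ n → H r (pred n) * (φ (pred n) - φ n)) ≡ pairing r N φ - H r N * φ N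
abel zero    zero    φ = solve 1 (λ a → con 0ℚ := a :- con 1ℚ :* a) refl (φ 0)
abel zero    (suc N) φ = trans (cong (_+ 1ℚ * (φ N - φ (suc N))) (abel zero N φ))
  (solve 3 (λ a b c → a :- con 1ℚ :* b :+ con 1ℚ :* (b :- c) := a :- con 1ℚ :* c) refl (φ 0) (φ N) (φ (suc N)))
abel (suc r) zero    φ = solve 1 (λ a → con 0ℚ := con 0ℚ :- con 0ℚ :* a) refl (φ 0)
abel (suc r) (suc N) φ = trans (cong (_+ H (suc r) N * (φ N - φ (suc N))) (abel (suc r) N φ))
  (solve 5 (λ p a k b c → p :- a :* b :+ a :* (b :- c) := p :+ c :* k :- (a :+ k) :* c) refl
    (pairing (suc r) N φ) (H (suc r) N) (h r (suc N)) (φ N) (φ (suc N)))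

module PathComposition (x : ℚ) where

  y : ℚ
  y = 1ℚ - x

  ζ₁ : ℕ → ℕ → ℚ
  ζ₁ r N = pairing r N (x ^_)

  -- Since ζ({1}_{r+1}; t) has derivative ζ({1}_r; t)/(1 - t), one integration by parts lowers r and
  -- keeps the exponent m. Truncation at N leaves the boundary term H r N · β x N m.
  pairing-β-suc : ∀ r N m → ι (suc m) * pairing (suc r) N (λ n → β x n m)
    ≡ y ^ suc m * ζ₁ (suc r) N + (pairing r N (λ n → β x n m) - H r N * β x N m)
  pairing-β-suc r N m = begin-equality
    ι (suc m) * ∑₁ N (λ n → β x n m * h r n)
      ≡⟨ sym (∑-distribˡ-* N (ι (suc m)) (λ n → β x n m * h r n)) ⟩
    ∑₁ N (λ n → ι (suc m) * (β x n m * h r n))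
      ≡⟨ ∑-cong⁺ N term ⟩
    ∑₁ N (λ n → y ^ suc m * (x ^ n * h r n) + H r (pred n) * (β x (pred n) m - β x n m))
      ≡⟨ ∑-distrib-+ N (λ n → y ^ suc m * (x ^ n * h r n)) _ ⟩
    ∑₁ N (λ n → y ^ suc m * (x ^ n * h r n)) + ∑₁ N (λ n → H r (pred n) * (β x (pred n) m - β x n m))
      ≡⟨ cong₂ _+_ (∑-distribˡ-* N (y ^ suc m) (λ n → x ^ n * h r n)) (abel r N (λ n → β x n m)) ⟩
    y ^ suc m * ζ₁ (suc r) N + (pairing r N (λ n → β x n m) - H r N * β x N m) ∎
    where
    term : ∀ k → ι (suc m) * (β x (suc k) m * h r (suc k))
      ≡ y ^ suc m * (x ^ suc k * h r (suc k)) + H r k * (β x k m - β x (suc k) m)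
    term k = begin-equality
      ι (suc m) * (b * w)                           ≡⟨ sym (*-assoc (ι (suc m)) b w) ⟩
      ι (suc m) * b * w                             ≡⟨ cong (_* w) (β-parts-Δ x (suc k) m) ⟩
      (p * q + ι (suc k) * (β x k m - b)) * w
        ≡⟨ solve 5 (λ p q i d w → (p :* q :+ i :* d) :* w := q :* (p :* w) :+ (i :* w) :* d)
             refl p q (ι (suc k)) (β x k m - b) w ⟩
      q * (p * w) + ι (suc k) * w * (β x k m - b)   ≡⟨ cong (λ t → q * (p * w) + t * (β x k m - b)) (ι*h r k) ⟩
      q * (p * w) + H r k * (β x k m - b)           ∎
      where
      b w p q : ℚ
      b = β x (suc k) m ; w = h r (suc k) ; p = x ^ suc k ; q = y ^ suc m

  main : ℕ → ℕ → ℕ → ℚ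
  main r N m = ∑₀ r λ j → ζ₁ (r ∸ j) N * (y ^ suc m * recip (suc m) ^ suc j)

  -- The boundary terms of `pairing-β-suc` accumulated over r integrations by parts, each divided by
  -- m + 1 once for its own step and once for every later one.
  err : ℕ → ℕ → ℕ → ℚ
  err zero    N m = 0ℚ
  err (suc r) N m = recip (suc m) * (err r N m + H r N * β x N m)

  pairing-β : ∀ r N m → pairing r N (λ n → β x n m) ≡ main r N m - err r N m
  pairing-β zero    N m = solve 2 (λ p r → p :* r := con 1ℚ :* (p :* (r :* con 1ℚ)) :- con 0ℚ) refl (y ^ suc m) (recip (suc m))
  pairing-β (suc r) N m = begin-equality
    pairing (suc r) N (λ n → β x n m)
      ≡⟨ recip-cancel m (pairing-β-suc r N m) ⟩
    u * (p * z + (pairing r N (λ n → β x n m) - t))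
      ≡⟨ cong (λ s → u * (p * z + (s - t))) (pairing-β r N m) ⟩
    u * (p * z + (main r N m - err r N m - t))
      ≡⟨ solve 6 (λ u p z a e t → u :* (p :* z :+ (a :- e :- t)) := z :* (p :* (u :* con 1ℚ)) :+ u :* a :- u :* (e :+ t))
           refl u p z (main r N m) (err r N m) t ⟩
    z * (p * (u * 1ℚ)) + u * main r N m - err (suc r) N m
      ≡⟨ cong (λ s → z * (p * (u * 1ℚ)) + s - err (suc r) N m) shift ⟩
    main (suc r) N m - err (suc r) N m ∎
    where
    u p z t : ℚ
    u = recip (suc m) ; p = y ^ suc m ; z = ζ₁ (suc r) N ; t = H r N * β x N m
    shift : u * main r N m ≡ ∑₀ r (λ j → ζ₁ (r ∸ j) N * (p * (u * u ^ suc j)))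
    shift = trans (sym (∑₀-distribˡ-* r u (λ j → ζ₁ (r ∸ j) N * (p * u ^ suc j))))
      (∑₀-cong r λ j _ → solve 4 (λ u z p q → u :* (z :* (p :* q)) := z :* (p :* (u :* q))) refl
        u (ζ₁ (r ∸ j) N) p (u ^ suc j))

  -- 1/t = ∑_{m < M} (1 - t)ᵐ + (1 - t)ᴹ/t under the integral sign
  expand-column : ∀ r N M → ∑₁ N (λ n → β x (pred n) 0 * h r n)
    ≡ ∑₁ M (λ m → pairing (suc r) N (λ n → β x n (pred m))) + ∑₁ N (λ n → β x (pred n) M * h r n)
  expand-column r N zero    = sym (+-identityˡ _)
  expand-column r N (suc M) = begin-equality
    ∑₁ N (λ n → β x (pred n) 0 * h r n)                   ≡⟨ expand-column r N M ⟩
    s + ∑₁ N (λ n → β x (pred n) M * h r n)               ≡⟨ cong (s +_) (∑-cong⁺ N split) ⟩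
    s + ∑₁ N (λ n → β x n M * h r n + β x (pred n) (suc M) * h r n)
      ≡⟨ cong (s +_) (∑-distrib-+ N (λ n → β x n M * h r n) (λ n → β x (pred n) (suc M) * h r n)) ⟩
    s + (∑₁ N (λ n → β x n M * h r n) + ∑₁ N (λ n → β x (pred n) (suc M) * h r n))
      ≡⟨ sym (+-assoc s _ _) ⟩
    s + ∑₁ N (λ n → β x n M * h r n) + ∑₁ N (λ n → β x (pred n) (suc M) * h r n) ∎
    where
    s : ℚ
    s = ∑₁ M (λ m → pairing (suc r) N (λ n → β x n (pred m)))
    split : ∀ k → β x k M * h r (suc k) ≡ β x (suc k) M * h r (suc k) + β x k (suc M) * h r (suc k)
    split k = solve 3 (λ a b w → a :* w := (a :- b) :* w :+ b :* w) refl (β x k M) (β x k (suc M)) (h r (suc k))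

  totalError : ℕ → ℕ → ℕ → ℚ
  totalError r N M = ∑₁ M λ m → err r N (pred m)

  -- The left-hand side is ∫ₓ¹ ζ({1}_{r+1}; t)/t dt with the series cut at N. Summing `main` over m
  -- turns the factors yᵐ⁺¹/(m+1)ʲ⁺¹ into partial sums of Li_{j+1}(y).
  path-composition : ∀ r N M → ∑₁ N (λ n → β x (pred n) 0 * h r n)
    ≡ ∑₀ (suc r) (λ j → ζ₁ (suc r ∸ j) N * ∑₁ M (Li-summand (suc j) y))
      + (∑₁ N (λ n → β x (pred n) M * h r n) - totalError (suc r) N M)
  path-composition r N M = begin-equality
    ∑₁ N (λ n → β x (pred n) 0 * h r n)      ≡⟨ expand-column r N M ⟩
    p + t                                    ≡⟨ solve 3 (λ p t e → p :+ t := (p :+ e) :+ (t :- e)) refl p t e ⟩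
    (p + e) + (t - e)
      ≡⟨ cong (_+ (t - e)) (begin-equality
           p + e
             ≡⟨ sym (∑-distrib-+ M (λ m → pairing (suc r) N (λ n → β x n (pred m))) (λ m → err (suc r) N (pred m))) ⟩
           ∑₁ M (λ m → pairing (suc r) N (λ n → β x n (pred m)) + err (suc r) N (pred m))
             ≡⟨ ∑-cong⁺ M (λ m → trans (cong (_+ err (suc r) N m) (pairing-β (suc r) N m))
                  (solve 2 (λ a e → a :- e :+ e := a) refl (main (suc r) N m) (err (suc r) N m))) ⟩
           ∑₁ M (λ m → ∑₀ (suc r) (λ j → ζ₁ (suc r ∸ j) N * Li-summand (suc j) y m))
             ≡⟨ ∑-∑₀-swap M (suc r) (λ j m → ζ₁ (suc r ∸ j) N * Li-summand (suc j) y m) ⟩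
           ∑₀ (suc r) (λ j → ∑₁ M (λ m → ζ₁ (suc r ∸ j) N * Li-summand (suc j) y m))
             ≡⟨ ∑₀-cong (suc r) (λ j _ → ∑-distribˡ-* M (ζ₁ (suc r ∸ j) N) (Li-summand (suc j) y)) ⟩
           ∑₀ (suc r) (λ j → ζ₁ (suc r ∸ j) N * ∑₁ M (Li-summand (suc j) y)) ∎) ⟩
    ∑₀ (suc r) (λ j → ζ₁ (suc r ∸ j) N * ∑₁ M (Li-summand (suc j) y)) + (t - e) ∎
    where
    p t e : ℚ
    p = ∑₁ M (λ m → pairing (suc r) N (λ n → β x n (pred m)))
    t = ∑₁ N (λ n → β x (pred n) M * h r n)
    e = totalError (suc r) N M

  module _ (0≤x : 0ℚ ≤ x) (x≤1 : x ≤ 1ℚ) where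

    err-nonneg : ∀ r N m → 0ℚ ≤ err r N m
    err-nonneg zero    N m = ≤-refl
    err-nonneg (suc r) N m = *-nonneg (recip-nonneg (suc m)) (+-nonneg (err-nonneg r N m)
      (*-nonneg (truncated-nonneg (replicate r 1) N) (β-nonneg 0≤x x≤1 N m)))

    β-row-sum : ∀ n M → ∑₁ M (λ m → β x (suc n) (pred m)) ≡ β x n 0 - β x n M
    β-row-sum n zero    = sym (+-inverseʳ (β x n 0))
    β-row-sum n (suc M) = trans (cong (_+ β x (suc n) M) (β-row-sum n M))
      (solve 3 (λ a b c → a :- b :+ (b :- c) := a :- c) refl (β x n 0) (β x n M) (β x n (suc M)))

    -- The bound is uniform in M: once 1/(m+1) ≤ 1 is discarded, the sum of β x N m over m
    -- telescopes to at most β x (N-1) 0 ≤ 1/N.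
    totalError-suc : ∀ r n M →
      totalError (suc r) (suc n) M ≤ totalError r (suc n) M + H r (suc n) * recip (suc n)
    totalError-suc r n M = begin
      totalError (suc r) N M
        ≤⟨ ∑-mono⁺ M (λ m _ → step m) ⟩
      ∑₁ M (λ m → err r N (pred m) + H r N * β x N (pred m))
        ≡⟨ ∑-distrib-+ M (λ m → err r N (pred m)) _ ⟩
      totalError r N M + ∑₁ M (λ m → H r N * β x N (pred m))
        ≡⟨ cong (totalError r N M +_) (trans (∑-distribˡ-* M (H r N) (λ m → β x N (pred m)))
             (cong (H r N *_) (β-row-sum n M))) ⟩
      totalError r N M + H r N * (β x n 0 - β x n M)
        ≤⟨ +-monoʳ-≤ (totalError r N M) (*-mono-l (H r N) (truncated-nonneg (replicate r 1) N)
             (≤-trans (p-q≤p (β x n 0) (β-nonneg 0≤x x≤1 n M)) (β≤recip 0≤x x≤1 n 0))) ⟩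
      totalError r N M + H r N * recip N ∎
      where
      N = suc n
      step : ∀ m → err (suc r) N m ≤ err r N m + H r N * β x N m
      step m = subst (err (suc r) N m ≤_) (*-identityˡ _) (*-mono-r _
        (+-nonneg (err-nonneg r N m) (*-nonneg (truncated-nonneg (replicate r 1) N) (β-nonneg 0≤x x≤1 N m)))
        (recip≤1 (suc m)))

    -- `G r` collects precisely the quotients H s N / N with s ≤ r, and `G→0` shows by Cesàro
    -- averaging that it vanishes in the limit.
    totalError≤G : ∀ r n M → totalError (suc r) (suc n) M ≤ G r (suc n)
    totalError≤G zero    n M = begin
      totalError 1 (suc n) M                            ≤⟨ totalError-suc 0 n M ⟩
      totalError 0 (suc n) M + H 0 (suc n) * recip (suc n)
        ≤⟨ +-monoˡ-≤ _ (≤-trans (∑-bounded M (λ _ _ → ≤-refl)) (≤-reflexive (*-zeroʳ (ι M)))) ⟩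
      0ℚ + H 0 (suc n) * recip (suc n)                  ≡⟨ +-identityˡ _ ⟩
      G 0 (suc n)                                       ∎
    totalError≤G (suc r) n M = ≤-trans (totalError-suc (suc r) n M)
      (+-monoˡ-≤ (H (suc r) (suc n) * recip (suc n)) (totalError≤G r n M))

    -- Each summand is at most yᴹ⁺¹/(M+1), and n ≤ M + 1 lets the denominator absorb their number;
    -- this is why both series may be cut at the same N.
    tail≤ : ∀ r n M → n ℕ.≤ suc M → ∑₁ n (λ k → β x (pred k) M * h r k) ≤ y ^ suc M
    tail≤ r n M n≤M = begin
      ∑₁ n (λ k → β x (pred k) M * h r k)      ≤⟨ ∑-bounded n (λ k _ → step k) ⟩
      ι n * (y ^ suc M * recip (suc M))
        ≡⟨ solve 3 (λ i p r → i :* (p :* r) := p :* (i :* r)) refl (ι n) (y ^ suc M) (recip (suc M)) ⟩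
      y ^ suc M * (ι n * recip (suc M))
        ≤⟨ *-mono-l (y ^ suc M) (^-nonneg (suc M) (p≤q⇒0≤q-p x≤1)) (ι*recip≤1 n≤M) ⟩
      y ^ suc M * 1ℚ                           ≡⟨ *-identityʳ (y ^ suc M) ⟩
      y ^ suc M                                ∎
      where
      step : ∀ k → β x k M * h r (suc k) ≤ β x 0 M
      step k = begin
        β x k M * h r (suc k)    ≤⟨ *-mono-l (β x k M) (β-nonneg 0≤x x≤1 k M) (h≤1 r k) ⟩
        β x k M * 1ℚ             ≡⟨ *-identityʳ (β x k M) ⟩
        β x k M                  ≤⟨ β-row-anti 0≤x x≤1 k M ⟩
        β x 0 M                  ∎

-- The composition formula at x = ½

open PathComposition ½ using (ζ₁)

½≤1 : ½ ≤ 1ℚ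
½≤1 = recip≤1 2

ζ-difference : ℕ → ℝ
ζ-difference r = ζ 2 (replicate r 1) -ᴿ ζ[ 2 , replicate r 1 ⨾ ½ ]

-- Termwise, one factor 1/k of 1/k² - ½ᵏ/k² goes to `h r k`, and the other forms (1 - ½ᵏ)/k, the
-- moment of tᵏ⁻¹.
ζ-difference-β : ∀ r N → seq (ζ-difference r) N ≡ ∑₁ N (λ n → β ½ (pred n) 0 * h r n)
ζ-difference-β r N = begin-equality
  ∑₁ N f - ∑₁ N g              ≡⟨ cong (_- ∑₁ N g) (∑-cong⁺ N term) ⟩
  ∑₁ N (λ n → d n + g n) - ∑₁ N g
    ≡⟨ cong (_- ∑₁ N g) (∑-distrib-+ N d g) ⟩
  ∑₁ N d + ∑₁ N g - ∑₁ N g     ≡⟨ solve 2 (λ d g → d :+ g :- g := d) refl (∑₁ N d) (∑₁ N g) ⟩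
  ∑₁ N d                       ∎
  where
  f g d : ℕ → ℚ
  f = ζ-summand 2 (replicate r 1) 1ℚ
  g = ζ-summand 2 (replicate r 1) ½
  d n = β ½ (pred n) 0 * h r n
  term : ∀ k → f (suc k) ≡ d (suc k) + g (suc k)
  term k = begin-equality
    1ℚ ^ suc k * (u * (u * 1ℚ) * a)
      ≡⟨ cong (_* (u * (u * 1ℚ) * a)) (1^n (suc k)) ⟩
    1ℚ * (u * (u * 1ℚ) * a)
      ≡⟨ solve 3 (λ u a p → con 1ℚ :* (u :* (u :* con 1ℚ) :* a) :=
           u :* (con 1ℚ :- p) :* (u :* con 1ℚ :* a) :+ p :* (u :* (u :* con 1ℚ) :* a)) refl u a (½ ^ suc k) ⟩
    u * (1ℚ - ½ ^ suc k) * (u * 1ℚ * a) + g (suc k)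
      ≡⟨ cong (λ t → t * (u * 1ℚ * a) + g (suc k)) (sym (recip-cancel k (β-column₀ ½ k))) ⟩
    d (suc k) + g (suc k) ∎
    where
    u a : ℚ
    u = recip (suc k) ; a = H r k

-- ζ(2,{1}_r) - ζ(2,{1}_r; ½) = ∑_{j ≤ r+1} ζ({1}_{r+1-j}; ½) Li_{j+1}(½)
ζ-difference≈ : ∀ r → seq (ζ-difference r)
  ≈ (λ N → ∑₀ (suc r) (λ j → ζ₁ (suc r ∸ j) N * seq (Li (suc j) ½) N))
ζ-difference≈ r = tends (Tends0-≤ 1 bound (Tends0-+ ½^→0 (G→0 r)))
  where
  open PathComposition ½ hiding (ζ₁)
  a : ℕ → ℚ
  a N = ∑₀ (suc r) (λ j → ζ₁ (suc r ∸ j) N * seq (Li (suc j) ½) N)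
  bound : ∀ N → 1 ℕ.≤ N → ∣ seq (ζ-difference r) N - a N ∣ ≤ ½ ^ N + G r N
  bound N@(suc n) _ = begin
    ∣ seq (ζ-difference r) N - a N ∣
      ≡⟨ cong (λ s → ∣ s - a N ∣) (trans (ζ-difference-β r N) (path-composition r N N)) ⟩
    ∣ a N + (t - e) - a N ∣
      ≡⟨ cong ∣_∣ (solve 2 (λ a d → a :+ d :- a := d) refl (a N) (t - e)) ⟩
    ∣ t - e ∣
      ≤⟨ ∣p-q∣≤p+q
           (∑-nonneg N λ k → *-nonneg (β-nonneg 0≤½ ½≤1 (pred k) N) (h-nonneg r k))
           (∑-nonneg N λ m → err-nonneg 0≤½ ½≤1 (suc r) N (pred m)) ⟩
    t + e
      ≤⟨ +-mono-≤ (≤-trans (tail≤ 0≤½ ½≤1 r N N (ℕ.n≤1+n N)) (^-anti 0≤½ ½≤1 (ℕ.n≤1+n N)))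
           (totalError≤G 0≤½ ½≤1 r n N) ⟩
    ½ ^ N + G r N ∎
    where
    t e : ℚ
    t = ∑₁ N (λ k → β ½ (pred k) N * h r k)
    e = totalError (suc r) N N

-- Cauchy products and the powers of ln 2

∑-cong< : ∀ n {f g} → (∀ k → k ℕ.< n → f (suc k) ≡ g (suc k)) → ∑₁ n f ≡ ∑₁ n g
∑-cong< zero    e = refl
∑-cong< (suc n) e = cong₂ _+_ (∑-cong< n λ k k<n → e k (ℕ.m<n⇒m<1+n k<n)) (e n ℕ.≤-refl)

-- Indices start at 1: `conv u v n` is the coefficient at n + 1 of the product series, and
-- `triangle u v n` sums u a · v b over a + b ≤ n.
conv triangle : (ℕ → ℚ) → (ℕ → ℚ) → ℕ → ℚ
conv     u v n = ∑₁ n λ a → u a * v (suc n ∸ a)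
triangle u v n = ∑₁ n λ a → u a * ∑₁ (n ∸ a) v

triangle-suc : ∀ u v n → triangle u v (suc n) ≡ triangle u v n + conv u v n
triangle-suc u v n = begin-equality
  ∑₁ n (λ a → u a * ∑₁ (suc n ∸ a) v) + u (suc n) * ∑₁ (n ∸ n) v
    ≡⟨ cong₂ _+_ (∑-cong< n term) (cong (λ k → u (suc n) * ∑₁ k v) (ℕ.n∸n≡0 n)) ⟩
  ∑₁ n (λ a → u a * ∑₁ (n ∸ a) v + u a * v (suc n ∸ a)) + u (suc n) * 0ℚ
    ≡⟨ cong₂ _+_ (∑-distrib-+ n (λ a → u a * ∑₁ (n ∸ a) v) (λ a → u a * v (suc n ∸ a))) (*-zeroʳ (u (suc n))) ⟩
  triangle u v n + conv u v n + 0ℚ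
    ≡⟨ +-identityʳ _ ⟩
  triangle u v n + conv u v n ∎
  where
  term : ∀ k → k ℕ.< n →
    u (suc k) * ∑₁ (n ∸ k) v ≡ u (suc k) * ∑₁ (n ∸ suc k) v + u (suc k) * v (n ∸ k)
  term k k<n = subst
    (λ l → u (suc k) * ∑₁ l v ≡ u (suc k) * ∑₁ (n ∸ suc k) v + u (suc k) * v l)
    (sym (ℕ.+-∸-assoc 1 k<n))
    (*-distribˡ-+ (u (suc k)) _ _)

-- the coefficient form of (∑ xⁿ/n) ζ({1}_{r+1}; x) = (r + 2) ζ({1}_{r+2}; x)
conv-recip-h : ∀ r n → conv recip (h r) n ≡ ι (suc (suc r)) * h (suc r) (suc n)
triangle-recip-h : ∀ r n → triangle recip (h r) n ≡ ι (suc (suc r)) * H (suc (suc r)) n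

conv-recip-h r n = begin-equality
  conv recip (h r) n
    ≡⟨ recip-cancel n scaled ⟩
  recip (suc n) * (ι (suc (suc r)) * H (suc r) n)
    ≡⟨ solve 3 (λ u i a → u :* (i :* a) := i :* (u :* con 1ℚ :* a)) refl (recip (suc n)) (ι (suc (suc r))) (H (suc r) n) ⟩
  ι (suc (suc r)) * h (suc r) (suc n) ∎
  where
  -- Leibniz rule on coefficients: n + 1 = a + b with a = k + 1 and b = n - k, where a cancels 1/a
  -- and b turns h r b into H r (b - 1).
  term : ∀ k → k ℕ.< n → ι (suc n) * (recip (suc k) * h r (n ∸ k)) ≡ h r (n ∸ k) + recip (suc k) * H r (n ∸ suc k)
  term k k<n = begin-equality
    ι (suc n) * (recip (suc k) * h r (n ∸ k))
      ≡⟨ cong₂ (λ i l → ι i * (recip (suc k) * h r l)) (trans (sym (ℕ.m+[n∸m]≡n (ℕ.m≤n⇒m≤1+n k<n))) (cong (suc k ℕ.+_) n∸k)) n∸k ⟩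
    ι (suc k ℕ.+ suc b) * (recip (suc k) * w)
      ≡⟨ cong (_* (recip (suc k) * w)) (ι-+ (suc k) (suc b)) ⟩
    (ι (suc k) + ι (suc b)) * (recip (suc k) * w)
      ≡⟨ solve 4 (λ i j u w → (i :+ j) :* (u :* w) := i :* (u :* w) :+ u :* (j :* w)) refl
           (ι (suc k)) (ι (suc b)) (recip (suc k)) w ⟩
    ι (suc k) * (recip (suc k) * w) + recip (suc k) * (ι (suc b) * w)
      ≡⟨ cong₂ (λ s t → s + recip (suc k) * t) (recip-inv-* k w) (ι*h r b) ⟩
    w + recip (suc k) * H r b
      ≡⟨ cong (λ l → h r l + recip (suc k) * H r b) (sym n∸k) ⟩
    h r (n ∸ k) + recip (suc k) * H r b ∎
    where
    b = n ∸ suc k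
    n∸k : n ∸ k ≡ suc b
    n∸k = ℕ.+-∸-assoc 1 k<n
    w : ℚ
    w = h r (suc b)
  -- `H (suc r)` is by definition the partial sum of `h r`, so this sum is a triangle one level
  -- lower; hence the mutual recursion.
  rest : ∀ r → ∑₁ n (λ a → recip a * H r (n ∸ a)) ≡ ι (suc r) * H (suc r) n
  rest zero    = trans (∑-cong n λ a → solve 1 (λ u → u :* con 1ℚ := u :* con 1ℚ :* con 1ℚ) refl (recip a))
    (sym (*-identityˡ (H 1 n)))
  rest (suc r) = triangle-recip-h r n
  scaled : ι (suc n) * conv recip (h r) n ≡ ι (suc (suc r)) * H (suc r) n
  scaled = begin-equality
    ι (suc n) * conv recip (h r) n
      ≡⟨ sym (∑-distribˡ-* n (ι (suc n)) (λ a → recip a * h r (suc n ∸ a))) ⟩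
    ∑₁ n (λ a → ι (suc n) * (recip a * h r (suc n ∸ a)))
      ≡⟨ ∑-cong< n term ⟩
    ∑₁ n (λ a → h r (suc n ∸ a) + recip a * H r (n ∸ a))
      ≡⟨ ∑-distrib-+ n (λ a → h r (suc n ∸ a)) (λ a → recip a * H r (n ∸ a)) ⟩
    ∑₁ n (λ a → h r (suc n ∸ a)) + ∑₁ n (λ a → recip a * H r (n ∸ a))
      ≡⟨ cong₂ _+_ (∑-reverse n (h r)) (rest r) ⟩
    H (suc r) n + ι (suc r) * H (suc r) n
      ≡⟨ solve 2 (λ a i → a :+ i :* a := (i :+ con 1ℚ) :* a) refl (H (suc r) n) (ι (suc r)) ⟩
    (ι (suc r) + 1ℚ) * H (suc r) n
      ≡⟨ cong (_* H (suc r) n) (sym (ι-suc (suc r))) ⟩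
    ι (suc (suc r)) * H (suc r) n ∎

triangle-recip-h r zero    = sym (*-zeroʳ (ι (suc (suc r))))
triangle-recip-h r (suc n) = begin-equality
  triangle recip (h r) (suc n)                      ≡⟨ triangle-suc recip (h r) n ⟩
  triangle recip (h r) n + conv recip (h r) n       ≡⟨ cong₂ _+_ (triangle-recip-h r n) (conv-recip-h r n) ⟩
  i * H (suc (suc r)) n + i * h (suc r) (suc n)     ≡⟨ sym (*-distribˡ-+ i _ _) ⟩
  i * H (suc (suc r)) (suc n)                       ∎
  where
  i : ℚ
  i = ι (suc (suc r))

^-+ : ∀ p m n → p ^ (m ℕ.+ n) ≡ p ^ m * p ^ n
^-+ p zero    n = sym (*-identityˡ (p ^ n))
^-+ p (suc m) n = trans (cong (p *_) (^-+ p m n)) (sym (*-assoc p (p ^ m) (p ^ n)))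

conv-^ : ∀ x u v n → conv (λ a → x ^ a * u a) (λ b → x ^ b * v b) n ≡ x ^ suc n * conv u v n
conv-^ x u v n = trans (∑-cong< n term) (∑-distribˡ-* n (x ^ suc n) (λ a → u a * v (suc n ∸ a)))
  where
  term : ∀ k → k ℕ.< n → x ^ suc k * u (suc k) * (x ^ (n ∸ k) * v (n ∸ k)) ≡ x ^ suc n * (u (suc k) * v (n ∸ k))
  term k k<n = trans
    (solve 4 (λ p u q v → p :* u :* (q :* v) := p :* q :* (u :* v)) refl (x ^ suc k) (u (suc k)) (x ^ (n ∸ k)) (v (n ∸ k)))
    (cong (_* (u (suc k) * v (n ∸ k))) (trans (sym (^-+ x (suc k) (n ∸ k)))
      (cong (x ^_) (ℕ.m+[n∸m]≡n (ℕ.m≤n⇒m≤1+n k<n)))))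

triangle-^-h : ∀ x r n → triangle (λ a → x ^ a * recip a) (λ b → x ^ b * h r b) n
  ≡ ι (suc (suc r)) * ∑₁ n (λ k → x ^ k * h (suc r) k)
triangle-^-h x r zero    = sym (*-zeroʳ (ι (suc (suc r))))
triangle-^-h x r (suc n) = begin-equality
  triangle u v (suc n)                ≡⟨ triangle-suc u v n ⟩
  triangle u v n + conv u v n
    ≡⟨ cong₂ _+_ (triangle-^-h x r n) (trans (conv-^ x recip (h r) n) (cong (x ^ suc n *_) (conv-recip-h r n))) ⟩
  i * s + x ^ suc n * (i * h (suc r) (suc n))
    ≡⟨ solve 4 (λ i s p w → i :* s :+ p :* (i :* w) := i :* (s :+ p :* w)) refl i s (x ^ suc n) (h (suc r) (suc n)) ⟩
  i * ∑₁ (suc n) (λ k → x ^ k * h (suc r) k) ∎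
  where
  u v : ℕ → ℚ
  u a = x ^ a * recip a
  v b = x ^ b * h r b
  i s : ℚ
  i = ι (suc (suc r)) ; s = ∑₁ n (λ k → x ^ k * h (suc r) k)

module CauchyProduct (u v : ℕ → ℚ) (0≤u : ∀ k → 0ℚ ≤ u (suc k)) (0≤v : ∀ k → 0ℚ ≤ v (suc k)) where

  0≤∑v : ∀ n → 0ℚ ≤ ∑₁ n v
  0≤∑v n = ∑-monoˡ {0} {n} v 0≤v z≤n

  product≡∑ : ∀ n → ∑₁ n u * ∑₁ n v ≡ ∑₁ n (λ a → u a * ∑₁ n v)
  product≡∑ n = trans (*-comm (∑₁ n u) (∑₁ n v)) (trans (sym (∑-distribˡ-* n (∑₁ n v) u))
    (∑-cong n λ a → *-comm (∑₁ n v) (u a)))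

  triangle≤product : ∀ n → triangle u v n ≤ ∑₁ n u * ∑₁ n v
  triangle≤product n = subst (triangle u v n ≤_) (sym (product≡∑ n))
    (∑-mono⁺ n λ k _ → *-mono-l (u (suc k)) (0≤u k) (∑-monoˡ v 0≤v (ℕ.m∸n≤m n (suc k))))

  product≤triangle : ∀ n → ∑₁ n u * ∑₁ n v ≤ triangle u v (n ℕ.+ n)
  product≤triangle n = begin
    ∑₁ n u * ∑₁ n v                               ≡⟨ product≡∑ n ⟩
    ∑₁ n (λ a → u a * ∑₁ n v)
      ≤⟨ ∑-mono⁺ n (λ k k<n → *-mono-l (u (suc k)) (0≤u k) (∑-monoˡ v 0≤v (n≤ k<n))) ⟩
    ∑₁ n (λ a → u a * ∑₁ (n ℕ.+ n ∸ a) v)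
      ≤⟨ ∑-monoˡ _ (λ k → *-nonneg (0≤u k) (0≤∑v (n ℕ.+ n ∸ suc k))) (ℕ.m≤m+n n n) ⟩
    triangle u v (n ℕ.+ n)                        ∎
    where
    n≤ : ∀ {k} → k ℕ.< n → n ℕ.≤ n ℕ.+ n ∸ suc k
    n≤ {k} k<n = subst (n ℕ.≤_) (sym (ℕ.+-∸-assoc n k<n)) (ℕ.m≤m+n n (n ∸ suc k))

  -- The square a, b ≤ n lies between the triangles a + b ≤ n and a + b ≤ 2n. As the terms are
  -- nonnegative, the Cauchy property of the triangle sums closes the gap.
  product≈triangle : ∀ z → (∀ n → triangle u v n ≡ seq z n) → (λ n → ∑₁ n u * ∑₁ n v) ≈ seq z
  product≈triangle z e = tends λ ε 0<ε →
    proj₁ (cauchy z ε 0<ε) , λ n p → begin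
      ∣ ∑₁ n u * ∑₁ n v - seq z n ∣
        ≡⟨ 0≤p⇒∣p∣≡p (p≤q⇒0≤q-p (subst (_≤ ∑₁ n u * ∑₁ n v) (e n) (triangle≤product n))) ⟩
      ∑₁ n u * ∑₁ n v - seq z n
        ≤⟨ +-monoˡ-≤ (- seq z n) (subst (∑₁ n u * ∑₁ n v ≤_) (e (n ℕ.+ n)) (product≤triangle n)) ⟩
      seq z (n ℕ.+ n) - seq z n            ≤⟨ p≤∣p∣ _ ⟩
      ∣ seq z (n ℕ.+ n) - seq z n ∣        ≤⟨ proj₂ (cauchy z ε 0<ε) (n ℕ.+ n) n (ℕ.≤-trans p (ℕ.m≤m+n n n)) p ⟩
      ε                                    ∎
    where
    p≤∣p∣ : ∀ p → p ≤ ∣ p ∣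
    p≤∣p∣ p with ≤-total 0ℚ p
    ... | inj₁ 0≤p = ≤-reflexive (sym (0≤p⇒∣p∣≡p 0≤p))
    ... | inj₂ p≤0 = ≤-trans p≤0 (0≤∣p∣ p)

-- Equips `ζ₁` with a Cauchy proof, which `≈-*ʳ` and `product≈triangle` ask for.
ζ₁ᴿ : ℕ → ℝ
ζ₁ᴿ zero    = fromℕ 1
ζ₁ᴿ (suc r) = ζ[ 1 , replicate r 1 ⨾ ½ ]

seq-ζ₁ᴿ : ∀ r n → seq (ζ₁ᴿ r) n ≡ ζ₁ r n
seq-ζ₁ᴿ zero    n = refl
seq-ζ₁ᴿ (suc r) n = refl

Li₁≡ : ∀ n → seq (Li 1 ½) n ≡ ∑₁ n (λ k → ½ ^ k * recip k)
Li₁≡ n = ∑-cong n λ k → cong (½ ^ k *_) (*-identityʳ (recip k))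

Li₁*ζ₁ : ∀ r → (λ n → seq (Li 1 ½) n * ζ₁ r n) ≈ (λ n → ι (suc r) * ζ₁ (suc r) n)
Li₁*ζ₁ zero    = ≡⇒≈ λ n → trans (*-comm (seq (Li 1 ½) (suc n)) 1ℚ)
  (cong (1ℚ *_) (∑-cong (suc n) λ k → cong (½ ^ k *_) (sym (*-identityʳ (recip k ^ 1)))))
Li₁*ζ₁ (suc r) = ≈-trans (≡⇒≈ λ n → cong (_* ζ₁ (suc r) (suc n)) (Li₁≡ (suc n)))
  (CauchyProduct.product≈triangle (λ k → ½ ^ k * recip k) (λ k → ½ ^ k * h r k)
    (λ k → *-nonneg (^-nonneg (suc k) 0≤½) (recip-nonneg (suc k)))
    (λ k → *-nonneg (^-nonneg (suc k) 0≤½) (h-nonneg r (suc k)))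
    (fromℕ (suc (suc r)) *ᴿ ζ₁ᴿ (suc (suc r))) (triangle-^-h ½ r))

seq-^ᴿ : ∀ x r n → seq (x ^ᴿ r) n ≡ seq x n ^ r
seq-^ᴿ x zero    n = refl
seq-^ᴿ x (suc r) n = cong (seq x n *_) (seq-^ᴿ x r n)

-- Induction on r: one factor ln 2 is traded for Li₁(½), and `Li₁*ζ₁` turns that factor into r + 1
-- while raising the depth.
ln2-power : ∀ r → (λ n → ι (r !) * ζ₁ r n) ≈ (λ n → seq (ln (ι 2)) n ^ r)
ln2-power zero    = ≡⇒≈ λ n → refl
ln2-power (suc r) = ≈-sym (≈-trans (≈-*ˡ (ln (ι 2)) (≈-sym (ln2-power r)))
  (≈-trans (≡⇒≈ λ n → cong (λ z → seq (ln (ι 2)) (suc n) * (ι (r !) * z)) (sym (seq-ζ₁ᴿ r (suc n))))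
  (≈-trans (≈-*ʳ (fromℕ (r !) *ᴿ ζ₁ᴿ r) ln2≈Li₁)
  (≈-trans (≡⇒≈ λ n → trans (cong (λ z → seq (Li 1 ½) (suc n) * (ι (r !) * z)) (seq-ζ₁ᴿ r (suc n)))
    (solve 3 (λ l f z → l :* (f :* z) := f :* (l :* z)) refl (seq (Li 1 ½) (suc n)) (ι (r !)) (ζ₁ r (suc n))))
  (≈-trans (≈-*ˡ (fromℕ (r !)) (Li₁*ζ₁ r))
  (≡⇒≈ λ n → trans (sym (*-assoc (ι (r !)) (ι (suc r)) (ζ₁ (suc r) (suc n))))
    (cong (_* ζ₁ (suc r) (suc n)) (trans (sym (ι-* (r !) (suc r))) (cong ι (ℕ.*-comm (r !) (suc r)))))))))))

-- Binomial inversion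

weight : ℚ → ℕ → ℕ → ℚ
weight c n i = ι (n C i) * c ^ (n ∸ i)

weight-pascal : ∀ c n i → weight c (suc n) (suc i) ≡ c * weight c n (suc i) + weight c n i
weight-pascal c n i = begin-equality
  ι (suc n C suc i) * c ^ (n ∸ i)
    ≡⟨ cong (λ k → ι k * c ^ (n ∸ i)) (sym (nCk+nC[k+1]≡[n+1]C[k+1] n i)) ⟩
  ι (n C i ℕ.+ n C suc i) * c ^ (n ∸ i)
    ≡⟨ cong (_* c ^ (n ∸ i)) (ι-+ (n C i) (n C suc i)) ⟩
  (ι (n C i) + ι (n C suc i)) * c ^ (n ∸ i)
    ≡⟨ trans (*-distribʳ-+ (c ^ (n ∸ i)) (ι (n C i)) (ι (n C suc i)))
         (+-comm (weight c n i) (ι (n C suc i) * c ^ (n ∸ i))) ⟩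
  ι (n C suc i) * c ^ (n ∸ i) + weight c n i
    ≡⟨ cong (_+ weight c n i) top ⟩
  c * weight c n (suc i) + weight c n i ∎
  where
  above : ¬ (i ℕ.< n) → n C suc i ≡ 0
  above i≮n = k>n⇒nCk≡0 (s≤s (ℕ.≮⇒≥ i≮n))
  top-case : Dec (i ℕ.< n) → ι (n C suc i) * c ^ (n ∸ i) ≡ c * weight c n (suc i)
  top-case (yes i<n) = trans (cong (λ l → ι (n C suc i) * c ^ l) (ℕ.+-∸-assoc 1 i<n))
    (solve 3 (λ a c p → a :* (c :* p) := c :* (a :* p)) refl (ι (n C suc i)) c (c ^ (n ∸ suc i)))
  -- Both sides vanish with n C (i + 1) = 0, whatever exponents truncated subtraction produces.
  top-case (no i≮n) = trans (cong (λ l → ι l * c ^ (n ∸ i)) (above i≮n))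
    (trans (solve 3 (λ c p q → con 0ℚ :* p := c :* (con 0ℚ :* q)) refl c (c ^ (n ∸ i)) (c ^ (n ∸ suc i)))
      (cong (λ l → c * (ι l * c ^ (n ∸ suc i))) (sym (above i≮n))))
  top = top-case (i ℕ.<? n)

weight-zero : ∀ c n → weight c n 0 ≡ c ^ n
weight-zero c n = *-identityˡ (c ^ n)

binomial : ℚ → ℕ → (ℕ → ℚ) → ℚ
binomial c n u = ∑₀ n λ i → weight c n i * u i

binomial-cong : ∀ c n {u v} → (∀ i → u i ≡ v i) → binomial c n u ≡ binomial c n v
binomial-cong c n e = ∑₀-cong n λ i _ → cong (weight c n i *_) (e i)

-- With E the shift of sequences, `binomial c n u` is (c + E)ⁿ u read at index 0; one factor c + E
-- is split off.
binomial-suc : ∀ c n u → binomial c (suc n) u ≡ c * binomial c n u + binomial c n (λ i → u (suc i))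
binomial-suc c n u = begin-equality
  weight c (suc n) 0 * u 0 + ∑₀ n (λ i → weight c (suc n) (suc i) * u (suc i))
    ≡⟨ cong₂ _+_ head (∑₀-cong n λ i _ → trans (cong (_* u (suc i)) (weight-pascal c n i))
         (solve 4 (λ c a b u → (c :* a :+ b) :* u := c :* (a :* u) :+ b :* u) refl c (weight c n (suc i)) (weight c n i) (u (suc i)))) ⟩
  c * f 0 + ∑₀ n (λ i → c * f (suc i) + weight c n i * u (suc i))
    ≡⟨ cong (c * f 0 +_) (∑₀-distrib-+ n (λ i → c * f (suc i)) (λ i → weight c n i * u (suc i))) ⟩
  c * f 0 + (∑₀ n (λ i → c * f (suc i)) + t)
    ≡⟨ sym (+-assoc (c * f 0) _ t) ⟩
  ∑₀ (suc n) (λ i → c * f i) + t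
    ≡⟨ cong (_+ t) (trans (∑₀-distribˡ-* (suc n) c f) (cong (c *_) (∑₀-last n f))) ⟩
  c * (binomial c n u + f (suc n)) + t
    ≡⟨ cong (λ s → c * (binomial c n u + s) + t) top ⟩
  c * (binomial c n u + 0ℚ) + t
    ≡⟨ cong (λ s → c * s + t) (+-identityʳ (binomial c n u)) ⟩
  c * binomial c n u + t ∎
  where
  f : ℕ → ℚ
  f i = weight c n i * u i
  t : ℚ
  t = binomial c n (λ i → u (suc i))
  head : weight c (suc n) 0 * u 0 ≡ c * f 0
  head = trans (cong (_* u 0) (trans (weight-zero c (suc n)) (cong (c *_) (sym (weight-zero c n)))))
    (*-assoc c (weight c n 0) (u 0))
  top : f (suc n) ≡ 0ℚ
  top = trans (cong (λ k → ι k * c ^ (n ∸ suc n) * u (suc n)) (k>n⇒nCk≡0 {n} {suc n} ℕ.≤-refl))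
    (solve 2 (λ p u → con 0ℚ :* p :* u := con 0ℚ) refl (c ^ (n ∸ suc n)) (u (suc n)))

binomial-linear : ∀ c n a b u v → binomial c n (λ i → a * u i + b * v i) ≡ a * binomial c n u + b * binomial c n v
binomial-linear c n a b u v = begin-equality
  binomial c n (λ i → a * u i + b * v i)
    ≡⟨ ∑₀-cong n (λ i _ → solve 5 (λ w a b u v → w :* (a :* u :+ b :* v) := a :* (w :* u) :+ b :* (w :* v)) refl
         (weight c n i) a b (u i) (v i)) ⟩
  ∑₀ n (λ i → a * (weight c n i * u i) + b * (weight c n i * v i))
    ≡⟨ ∑₀-distrib-+ n (λ i → a * (weight c n i * u i)) _ ⟩
  ∑₀ n (λ i → a * (weight c n i * u i)) + ∑₀ n (λ i → b * (weight c n i * v i))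
    ≡⟨ cong₂ _+_ (∑₀-distribˡ-* n a (λ i → weight c n i * u i)) (∑₀-distribˡ-* n b (λ i → weight c n i * v i)) ⟩
  a * binomial c n u + b * binomial c n v ∎

-- In terms of the shift E this is (c - (c + E))ⁿ = (- E)ⁿ. In the induction the two multiples of c
-- cancel and only the shifted sequence survives.
binomial-inversion : ∀ c n u → binomial c n (λ i → (- 1ℚ) ^ i * binomial c i u) ≡ (- 1ℚ) ^ n * u n
binomial-inversion c zero    u = solve 1 (λ a → con 1ℚ :* (con 1ℚ :* (con 1ℚ :* a)) := con 1ℚ :* a) refl (u 0)
binomial-inversion c (suc n) u = begin-equality
  binomial c (suc n) v
    ≡⟨ binomial-suc c n v ⟩
  c * binomial c n v + binomial c n (λ i → v (suc i))
    ≡⟨ cong (c * binomial c n v +_) (trans (binomial-cong c n v-suc) (binomial-linear c n (- c) (- 1ℚ) v v₁)) ⟩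
  c * binomial c n v + (- c * binomial c n v + - 1ℚ * binomial c n v₁)
    ≡⟨ solve 3 (λ c b d → c :* b :+ (:- c :* b :+ con (- 1ℚ) :* d) := con (- 1ℚ) :* d) refl c (binomial c n v) (binomial c n v₁) ⟩
  - 1ℚ * binomial c n v₁
    ≡⟨ cong (- 1ℚ *_) (binomial-inversion c n (λ i → u (suc i))) ⟩
  - 1ℚ * ((- 1ℚ) ^ n * u (suc n))
    ≡⟨ sym (*-assoc (- 1ℚ) ((- 1ℚ) ^ n) (u (suc n))) ⟩
  (- 1ℚ) ^ suc n * u (suc n) ∎
  where
  v v₁ : ℕ → ℚ
  v  i = (- 1ℚ) ^ i * binomial c i u
  v₁ i = (- 1ℚ) ^ i * binomial c i (λ j → u (suc j))
  v-suc : ∀ i → v (suc i) ≡ - c * v i + - 1ℚ * v₁ i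
  v-suc i = trans (cong (- 1ℚ * (- 1ℚ) ^ i *_) (binomial-suc c i u))
    (solve 4 (λ s c b d → con (- 1ℚ) :* s :* (c :* b :+ d) := :- c :* (s :* b) :+ con (- 1ℚ) :* (s :* d)) refl
      ((- 1ℚ) ^ i) c (binomial c i u) (binomial c i (λ j → u (suc j))))

binomial-inversion₁ : ∀ c k u →
  ∑₁ k (λ i → weight c k i * ((- 1ℚ) ^ i * binomial c i u)) ≡ (- 1ℚ) ^ k * u k - c ^ k * u 0
binomial-inversion₁ c k u = begin-equality
  ∑₁ k f                            ≡⟨ solve 2 (λ a s → s := a :+ s :- a) refl (f 0) (∑₁ k f) ⟩
  f 0 + ∑₁ k f - f 0                ≡⟨ cong (_- f 0) (sym (∑₀≡head+∑₁ k f)) ⟩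
  ∑₀ k f - f 0                      ≡⟨ cong₂ _-_ (binomial-inversion c k u) f₀ ⟩
  (- 1ℚ) ^ k * u k - c ^ k * u 0    ∎
  where
  f : ℕ → ℚ
  f i = weight c k i * ((- 1ℚ) ^ i * binomial c i u)
  f₀ : f 0 ≡ c ^ k * u 0
  f₀ = trans (cong (_* (1ℚ * binomial c 0 u)) (weight-zero c k))
    (solve 2 (λ p a → p :* (con 1ℚ :* (con 1ℚ :* con 1ℚ :* a)) := p :* a) refl (c ^ k) (u 0))

-- Factorials, termwise limits and assembly

nCk*[n-k]!*k! : ∀ {n k} → k ℕ.≤ n → (n C k) ℕ.* ((n ∸ k) ! ℕ.* k !) ≡ n !
nCk*[n-k]!*k! {n} {k} k≤n = trans
  (cong₂ ℕ._*_ (nCk≡n!/k![n-k]! k≤n) (ℕ.*-comm ((n ∸ k) !) (k !)))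
  (m/n*n≡m {{k ℕ.!* (n ∸ k) !≢0}} (k![n∸k]!∣n! k≤n))

∑₀-≈ : ∀ k (f g : ℕ → ℕ → ℚ) → (∀ i → f i ≈ g i) → (λ n → ∑₀ k (λ i → f i n)) ≈ (λ n → ∑₀ k (λ i → g i n))
∑₀-≈ zero    f g e = e 0
∑₀-≈ (suc k) f g e = ≈-+ (e 0) (∑₀-≈ k (λ i → f (suc i)) (λ i → g (suc i)) (λ i → e (suc i)))

∑ᴿ-≈ : ∀ k f (g : ℕ → ℕ → ℚ) → (∀ i → seq (f (suc i)) ≈ g (suc i)) → seq (∑ᴿ k f) ≈ (λ n → ∑₁ k (λ i → g i n))
∑ᴿ-≈ zero    f g e = ≈-refl
∑ᴿ-≈ (suc k) f g e = ≈-+ (∑ᴿ-≈ k f g e) (e k)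

scaledLi : ℕ → ℕ → ℚ
scaledLi n j = ι (j !) * seq (Li (suc j) ½) n

-- Writing i! = C(i,j) (i-j)! j!, the factor (i-j)! completes ζ({1}_{i-j}; ½) to (ln 2)ⁱ⁻ʲ and j!
-- goes to Li_{j+1}(½).
ζ-difference-binomial : ∀ r → (λ n → ι (suc r !) * seq (ζ-difference r) n)
  ≈ (λ n → binomial (seq (ln (ι 2)) n) (suc r) (scaledLi n))
ζ-difference-binomial r = ≈-trans (≈-*ˡ (fromℕ (i !)) (ζ-difference≈ r))
  (≈-trans (≡⇒≈ λ n → regroup (suc n))
    (∑₀-≈ i _ _ λ j → ≈-*ʳ (fromℕ (j !) *ᴿ Li (suc j) ½) (≈-*ˡ (fromℕ (i C j)) (ln2-power (i ∸ j)))))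
  where
  i = suc r
  regroup : ∀ n → ι (i !) * ∑₀ i (λ j → ζ₁ (i ∸ j) n * seq (Li (suc j) ½) n)
    ≡ ∑₀ i (λ j → ι (i C j) * (ι ((i ∸ j) !) * ζ₁ (i ∸ j) n) * scaledLi n j)
  regroup n = trans (sym (∑₀-distribˡ-* i (ι (i !)) (λ j → ζ₁ (i ∸ j) n * seq (Li (suc j) ½) n)))
    (∑₀-cong i λ j j≤i → begin-equality
      ι (i !) * (ζ₁ (i ∸ j) n * seq (Li (suc j) ½) n)
        ≡⟨ cong (_* (ζ₁ (i ∸ j) n * seq (Li (suc j) ½) n)) (trans (cong ι (sym (nCk*[n-k]!*k! j≤i)))
             (trans (ι-* (i C j) _) (cong (ι (i C j) *_) (ι-* ((i ∸ j) !) (j !))))) ⟩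
      ι (i C j) * (ι ((i ∸ j) !) * ι (j !)) * (ζ₁ (i ∸ j) n * seq (Li (suc j) ½) n)
        ≡⟨ solve 5 (λ a b c z l → a :* (b :* c) :* (z :* l) := a :* (b :* z) :* (c :* l)) refl
             (ι (i C j)) (ι ((i ∸ j) !)) (ι (j !)) (ζ₁ (i ∸ j) n) (seq (Li (suc j) ½) n) ⟩
      ι (i C j) * (ι ((i ∸ j) !) * ζ₁ (i ∸ j) n) * scaledLi n j ∎)

mainTheorem8 : (k : ℕ) → .{{_ : NonZero k}} →
    ∑ᴿ k (λ i → (-ᴿ fromℕ 1) ^ᴿ i *ᴿ fromℕ (i !) *ᴿ ln (ι 2) ^ᴿ (k ∸ i) *ᴿ fromℕ (k C i)
    *ᴿ (ζ 2 (replicate (i ∸ 1) 1) -ᴿ ζ[ 2 , replicate (i ∸ 1) 1 ⨾ ½ ]))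
    ≃ (-ᴿ fromℕ 1) ^ᴿ k *ᴿ fromℕ (k !) *ᴿ Li (suc k) ½ -ᴿ ln (ι 2) ^ᴿ suc k
mainTheorem8 k = ≈⇒≃ lhs rhs
  (≈-trans (∑ᴿ-≈ k _ inverted term≈)
  -- Exact at every index, with c the Riemann sum for ln 2 at that index.
  (≈-trans (≡⇒≈ λ n → binomial-inversion₁ (seq (ln (ι 2)) (suc n)) k (scaledLi (suc n)))
  (≈-+ main≈ power≈)))
  where
  -- Spelled out: an abbreviation of a term would be compared with the statement by
  -- unfolding the reals down to their moduli of convergence.
  lhs rhs : ℝ
  lhs = ∑ᴿ k (λ i → (-ᴿ fromℕ 1) ^ᴿ i *ᴿ fromℕ (i !) *ᴿ ln (ι 2) ^ᴿ (k ∸ i) *ᴿ fromℕ (k C i)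
    *ᴿ (ζ 2 (replicate (i ∸ 1) 1) -ᴿ ζ[ 2 , replicate (i ∸ 1) 1 ⨾ ½ ]))
  rhs = (-ᴿ fromℕ 1) ^ᴿ k *ᴿ fromℕ (k !) *ᴿ Li (suc k) ½ -ᴿ ln (ι 2) ^ᴿ suc k
  sign : ℕ → ℝ
  sign i = (-ᴿ fromℕ 1) ^ᴿ i
  inverted : ℕ → ℕ → ℚ
  inverted i n = weight (seq (ln (ι 2)) n) k i * ((- 1ℚ) ^ i * binomial (seq (ln (ι 2)) n) i (scaledLi n))
  coefficient : ℕ → ℝ
  coefficient i = fromℕ (k C i) *ᴿ ln (ι 2) ^ᴿ (k ∸ i) *ᴿ sign i
  -- Indexed by r = i - 1, so that `i ∸ 1` in the depth of the zeta values reduces.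
  term≈ : ∀ r → let i = suc r in
    seq (sign i *ᴿ fromℕ (i !) *ᴿ ln (ι 2) ^ᴿ (k ∸ i) *ᴿ fromℕ (k C i) *ᴿ ζ-difference r) ≈ inverted (suc r)
  term≈ r = ≈-trans
    (≡⇒≈ λ n → solve 5 (λ s f l c d → s :* f :* l :* c :* d := c :* l :* s :* (f :* d)) refl
      (seq (sign i) (suc n)) (ι (i !)) (seq (ln (ι 2) ^ᴿ (k ∸ i)) (suc n)) (ι (k C i)) (seq (ζ-difference r) (suc n)))
    (≈-trans (≈-*ˡ (coefficient i) (ζ-difference-binomial r))
    (≡⇒≈ λ n → trans
      (cong₂ (λ l s → ι (k C i) * l * s * binomial (seq (ln (ι 2)) (suc n)) i (scaledLi (suc n)))
        (seq-^ᴿ (ln (ι 2)) (k ∸ i) (suc n)) (seq-^ᴿ (-ᴿ fromℕ 1) i (suc n)))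
      (*-assoc (weight (seq (ln (ι 2)) (suc n)) k i) ((- 1ℚ) ^ i) _)))
    where i = suc r
  main≈ : (λ n → (- 1ℚ) ^ k * scaledLi n k) ≈ seq (sign k *ᴿ fromℕ (k !) *ᴿ Li (suc k) ½)
  main≈ = ≡⇒≈ λ n → trans (sym (*-assoc ((- 1ℚ) ^ k) (ι (k !)) (seq (Li (suc k) ½) (suc n))))
    (cong (λ s → s * ι (k !) * seq (Li (suc k) ½) (suc n)) (sym (seq-^ᴿ (-ᴿ fromℕ 1) k (suc n))))
  power≈ : (λ n → - (seq (ln (ι 2)) n ^ k * scaledLi n 0)) ≈ seq (-ᴿ ln (ι 2) ^ᴿ suc k)
  power≈ = ≈-trans
    (≡⇒≈ λ n → trans (cong (λ p → - (p * scaledLi (suc n) 0)) (sym (seq-^ᴿ (ln (ι 2)) k (suc n))))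
      (solve 2 (λ p l → :- (p :* (con 1ℚ :* l)) := :- p :* l) refl (seq (ln (ι 2) ^ᴿ k) (suc n)) (seq (Li 1 ½) (suc n))))
    (≈-trans (≈-*ˡ (-ᴿ ln (ι 2) ^ᴿ k) (≈-sym ln2≈Li₁))
    (≡⇒≈ λ n → solve 2 (λ p l → :- p :* l := :- (l :* p)) refl (seq (ln (ι 2) ^ᴿ k) (suc n)) (seq (ln (ι 2)) (suc n))))
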